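{- Let $p$ be a prime and $a,b,c$ positive integers such that $c$ is a primitive divisor of $p^a-1$ and $bc$ is a primitive divisor of $p^{ab}-1$. Then $$w\!\left(\tfrac{p^{ab}-1}{bc},p^{ab}\right)=b\, w\!\left(\tfrac{p^a-1}{c},p^a\right).$$
   Context: An integer $d$ is a primitive divisor of $p^n-1$ if $d\mid p^n-1$ and $d\nmid p^t-1$ for all $1\le t<n$. For a prime power $q$ and $k\in\mathbb{N}$, the weak Waring number $w(k,q)$ is the least $s\in\mathbb{N}$ (if it exists) such that every $a\in\mathbb{F}_q$ can be written as $a=\pm x_1^k\pm\cdots\pm x_s^k$ with $x_i\in\mathbb{F}_q$ and independent choices of signs. -}

module Defs where

open import Level using (0ℓ)
open import Data.Nat using (ℕ; zero; suc; _∸_; _^_; _≤_; _<_)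
open import Data.Nat.Divisibility using (_∣_)
open import Data.Fin using (Fin)
import Data.Fin as Fin
open import Data.Bool using (Bool; true; false)
open import Data.Product using (Σ; ∃; _×_; _,_)
open import Relation.Nullary using (¬_)
open import Relation.Binary.PropositionalEquality using (_≡_)
open import Algebra.Bundles using (CommutativeRing)

PrimitiveDivisor : ℕ → ℕ → ℕ → Set
PrimitiveDivisor d p n =
  (d ∣ p ^ n ∸ 1) × (∀ t → 1 ≤ t → t < n → ¬ (d ∣ p ^ t ∸ 1))

record FiniteField : Set₁ where
  field
    cring : CommutativeRing 0ℓ 0ℓ
  open CommutativeRing cring public
  field
    0≉1       : ¬ (0# ≈ 1#)
    inverse   : ∀ x → ¬ (x ≈ 0#) → ∃ λ y → (x * y) ≈ 1#
    size      : ℕ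
    enum      : Fin size → Carrier
    enum-surj : ∀ x → ∃ λ i → enum i ≈ x
    enum-inj  : ∀ i j → enum i ≈ enum j → i ≡ j

module _ (F : FiniteField) where
  open FiniteField F

  pow : Carrier → ℕ → Carrier
  pow x zero    = 1#
  pow x (suc n) = x * pow x n

  signed : Bool → Carrier → Carrier
  signed true  y = y
  signed false y = - y

  signedSum : (k s : ℕ) → (Fin s → Bool) → (Fin s → Carrier) → Carrier
  signedSum k zero    ε x = 0#
  signedSum k (suc s) ε x =
    signed (ε Fin.zero) (pow (x Fin.zero) k) + signedSum k s (λ i → ε (Fin.suc i)) (λ i → x (Fin.suc i))

  Representable : ℕ → ℕ → Set
  Representable k s = ∀ a → Σ (Fin s → Bool) λ ε → Σ (Fin s → Carrier) λ x → signedSum k s ε x ≈ a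

  IsWeakWaringNumber : ℕ → ℕ → Set
  IsWeakWaringNumber k s = (1 ≤ s) × Representable k s × (∀ t → 1 ≤ t → Representable k t → s ≤ t)

{-# OPTIONS --safe #-}
module Submission where

-- Let q = p^a. The nonzero k₂-th powers of F₂ are the powers of an element ω of order bc, and those of F₁
-- are the c-th roots of unity. Since bc is a primitive divisor of q^b − 1, the conjugates ω^(q^j), j < b,
-- are distinct, so a polynomial of degree < b over the subfield F_q ⊂ F₂ that vanishes at ω is zero;
-- by counting, 1, ω, …, ω^(b−1) is a basis of F₂ over F_q. As ω^b has order c, every k₂-th power is
-- ω^i times a k₁-th power of F_q with i < b. Hence Σ ω^i y_i is a signed sum of t k₂-th powers iff each y_i
-- is a signed sum of t_i k₁-th powers with Σ t_i = t; the worst case is y_i = y for a hardest y.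
-- The same basis argument over the prime field shows that the powers of an element of order c span F₁,
-- so that a Waring number exists. The embedding F₁ → F₂ comes from a common root in F₂ of the
-- relations satisfied in F₁ by a primitive element.

open import Defs
import Data.Nat as ℕ
open ℕ using (ℕ; zero; suc; s≤s; z≤n)
import Data.Nat.Properties as ℕₚ
open import Data.Nat.Combinatorics using (_C_; k![n∸k]!∣n!; nCn≡1)
open import Data.Nat.Combinatorics.Specification using (nCk≡n!/k![n-k]!)
open import Data.Nat.Coprimality as Coprimality using (Coprime; coprime-Bézout; coprime-divisor)
open import Data.Nat.Divisibility using (_∣_; _∣?_; divides; 1∣_; ∣-refl; ∣-trans; ∣⇒≤; m∣m*n; n∣m*n; *-monoˡ-∣; *-cancelˡ-∣)
open import Data.Nat.DivMod using (_mod_; _%_; _/_; m≡m%n+[m/n]*n; m%n<n; m/n*n≡m)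
open import Data.Nat.GCD using (module Bézout)
open import Data.Nat.Induction using (<-rec)
open import Data.Nat.Primality using (Prime; prime⇒irreducible; prime⇒nonTrivial; prime⇒nonZero; euclidsLemma)
open import Data.Nat.Primality.Factorisation using (PrimeFactorisation; factorise)
open import Data.Bool using (Bool; true; false)
open import Data.Empty using (⊥; ⊥-elim)
open import Data.Fin using (Fin; zero; suc; toℕ; fromℕ; fromℕ<; cast; combine; finToFun; funToFin; inject₁; inject≤; punchIn; punchOut)
open import Data.Fin.Permutation using (Permutation; permutation; _⟨$⟩ʳ_)
import Data.Fin.Properties as Finₚ
open import Data.List using (List; []; _∷_; _++_; map; allFin; cartesianProductWith)
open import Data.List.Membership.Propositional using (_∈_; find)
open import Data.List.Membership.Propositional.Properties using (∈-allFin; ∈-++⁺ˡ; ∈-++⁺ʳ; ∈-++⁻; ∈-cartesianProductWith⁺; ∈-cartesianProductWith⁻)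
open import Data.List.Relation.Unary.All as All using (All; _∷_)
open import Data.List.Relation.Unary.All.Properties using (¬All⇒Any¬)
open import Data.List.Relation.Unary.Any using (here; there)
open import Data.Product using (Σ; ∃; ∃₂; _×_; _,_; proj₁; proj₂)
open import Data.Sum using (_⊎_; inj₁; inj₂)
open import Data.Vec.Functional as Vector using (updateAt)
open import Data.Vec.Functional.Properties using (updateAt-updates; updateAt-minimal)
open import Function using (_∘_)
open import Relation.Binary.PropositionalEquality as ≡ using (_≡_; _≢_)
open import Relation.Nullary using (¬_; Dec; yes; no)
open import Relation.Nullary.Decidable using (map′; decidable-stable; ¬?; _⊎-dec_; _×-dec_)
open import Relation.Unary using (Decidable)
import Algebra.Properties.CommutativeMonoid.Sum as MonoidSum
import Algebra.Properties.CommutativeSemiring.Binomial as Binomial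
import Algebra.Properties.CommutativeSemiring.Exp as CommutativeSemiringExp
import Algebra.Properties.Ring as RingProperties
import Algebra.Properties.Semiring.Exp as SemiringExp
import Algebra.Properties.Semiring.Mult as SemiringMult
import Algebra.Solver.Ring.NaturalCoefficients.Default as NatSolver
import Relation.Binary.Reasoning.Setoid as SetoidReasoning

-- The obstacle is that `F₁` and `F₂` are unrelated fields: coordinates of `F₂` can be compared with
-- elements of `F₁` only after an embedding has been produced, and this takes about as much work as
-- the counting. Polynomials with natural coefficients serve there because one and the same
-- polynomial can be evaluated in both fields. The equality of the two numbers splits along the two
-- halves of the basis property. Spanning gives the upper bound: a factor ω^i is itself a k₂-th
-- power, so multiplying a signed sum by it costs no further terms. Uniqueness of coordinates gives
-- the lower bound: a term ±x^k₂ lies on a single basis line, so it can serve only one coordinate.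
-- Primitivity enters through one remark: an element of order d is fixed by x ↦ x^n exactly when d
-- divides n - 1. Thus c and bc being primitive divisors says that ζ, of order c, and ω have as many
-- conjugates as the degree of the extension. Every existence claim is a search over a finite set
-- with decidable equality, so no classical reasoning is involved.

module FieldTheory (F : FiniteField) where

  open FiniteField F hiding (zero) public
  open RingProperties ring using (-‿distribˡ-*; x+x≈x⇒x≈0; x∙y⁻¹≈ε⇒x≈y; +-identityˡ-unique; +-identityʳ-unique; +-inverseʳ-unique; x≈y⇒x∙y⁻¹≈ε; +-cancelʳ) public
  open SemiringMult semiring public
    using (×-homo-+; ×-congʳ; ×1-homo-*) renaming (_×_ to _·_)
  open NatSolver commutativeSemiring using (solve; _:=_; _:+_; _:*_)
  open SetoidReasoning setoid

  -- Powers and cancellation in a finite field.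

  infixr 8 _^_
  _^_ : Carrier → ℕ → Carrier
  _^_ = pow F

  ^≡ : ∀ x n → x ^ n ≡ (let open SemiringExp semiring renaming (_^_ to _^ˢ_) in x ^ˢ n)
  ^≡ x zero    = ≡.refl
  ^≡ x (suc n) = ≡.cong (x *_) (^≡ x n)

  ^-cong : ∀ n {x y} → x ≈ y → x ^ n ≈ y ^ n
  ^-cong zero    _   = refl
  ^-cong (suc n) x≈y = *-cong x≈y (^-cong n x≈y)

  ^-congʳ : ∀ x {m n} → m ≡ n → x ^ m ≈ x ^ n
  ^-congʳ x ≡.refl = refl

  ^-+ : ∀ x m n → x ^ (m ℕ.+ n) ≈ x ^ m * x ^ n
  ^-+ x m n rewrite ^≡ x (m ℕ.+ n) | ^≡ x m | ^≡ x n = SemiringExp.^-homo-* semiring x m n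

  ^-* : ∀ x m n → (x ^ m) ^ n ≈ x ^ (m ℕ.* n)
  ^-* x m n rewrite ^≡ (x ^ m) n | ^≡ x m | ^≡ x (m ℕ.* n) = SemiringExp.^-assocʳ semiring x m n

  ^-distrib-* : ∀ x y n → (x * y) ^ n ≈ x ^ n * y ^ n
  ^-distrib-* x y n rewrite ^≡ (x * y) n | ^≡ x n | ^≡ y n =
    CommutativeSemiringExp.^-distrib-* commutativeSemiring x y n

  1^ : ∀ n → 1# ^ n ≈ 1#
  1^ zero    = refl
  1^ (suc n) = trans (*-identityˡ _) (1^ n)

  0^ : ∀ {n} → 1 ℕ.≤ n → 0# ^ n ≈ 0#
  0^ {suc n} _ = zeroˡ _

  ^-swap : ∀ x m n → (x ^ m) ^ n ≈ (x ^ n) ^ m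
  ^-swap x m n = trans (^-* x m n) (trans (^-congʳ x (ℕₚ.*-comm m n)) (sym (^-* x n m)))

  ^≈1-multiple : ∀ {x n} m → x ^ n ≈ 1# → x ^ (m ℕ.* n) ≈ 1#
  ^≈1-multiple {x} {n} m e = begin
    x ^ (m ℕ.* n)  ≈⟨ ^-congʳ x (ℕₚ.*-comm m n) ⟩
    x ^ (n ℕ.* m)  ≈⟨ ^-* x n m ⟨
    (x ^ n) ^ m    ≈⟨ ^-cong m e ⟩
    1# ^ m         ≈⟨ 1^ m ⟩
    1#             ∎

  infix 4 _≟_
  _≟_ : ∀ x y → Dec (x ≈ y)
  x ≟ y with enum-surj x | enum-surj y
  ... | i , ei | j , ej with i Finₚ.≟ j
  ...   | yes ≡.refl = yes (trans (sym ei) ej)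
  ...   | no  i≢j    = no λ x≈y → i≢j (enum-inj i j (trans ei (trans x≈y (sym ej))))

  1≉0 : ¬ (1# ≈ 0#)
  1≉0 e = 0≉1 (sym e)

  *-zero-product : ∀ {x y} → ¬ (x ≈ 0#) → x * y ≈ 0# → y ≈ 0#
  *-zero-product {x} {y} x≉0 xy≈0 with inverse x x≉0
  ... | z , xz≈1 = begin
    y            ≈⟨ *-identityˡ y ⟨
    1# * y       ≈⟨ *-congʳ xz≈1 ⟨
    x * z * y    ≈⟨ solve 3 (λ x z y → x :* z :* y := z :* (x :* y)) refl x z y ⟩
    z * (x * y)  ≈⟨ *-congˡ xy≈0 ⟩
    z * 0#       ≈⟨ zeroʳ z ⟩
    0#           ∎

  *-cancelˡ : ∀ {x y z} → ¬ (x ≈ 0#) → x * y ≈ x * z → y ≈ z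
  *-cancelˡ {x} {y} {z} x≉0 e with inverse x x≉0
  ... | w , xw≈1 = begin
    y            ≈⟨ lemma y ⟨
    w * (x * y)  ≈⟨ *-congˡ e ⟩
    w * (x * z)  ≈⟨ lemma z ⟩
    z            ∎
    where
    lemma : ∀ y → w * (x * y) ≈ y
    lemma y = begin
      w * (x * y)  ≈⟨ solve 3 (λ x z y → z :* (x :* y) := x :* z :* y) refl x w y ⟩
      x * w * y    ≈⟨ *-congʳ xw≈1 ⟩
      1# * y       ≈⟨ *-identityˡ y ⟩
      y            ∎

  *-cancelʳ-distinct : ∀ {x y z} → ¬ (x ≈ y) → x * z ≈ y * z → z ≈ 0#
  *-cancelʳ-distinct {x} {y} {z} x≉y e =
    *-zero-product (λ e′ → x≉y (x∙y⁻¹≈ε⇒x≈y x y e′)) (begin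
      (x - y) * z          ≈⟨ distribʳ z x (- y) ⟩
      x * z + - y * z      ≈⟨ +-congˡ (-‿distribˡ-* y z) ⟨
      x * z + - (y * z)    ≈⟨ x≈y⇒x∙y⁻¹≈ε e ⟩
      0#                   ∎)

  *-≉0 : ∀ {x y} → ¬ (x ≈ 0#) → ¬ (y ≈ 0#) → ¬ (x * y ≈ 0#)
  *-≉0 x≉0 y≉0 e = y≉0 (*-zero-product x≉0 e)

  ^-≉0 : ∀ {x} n → ¬ (x ≈ 0#) → ¬ (x ^ n ≈ 0#)
  ^-≉0 zero    x≉0 = 1≉0
  ^-≉0 (suc n) x≉0 = *-≉0 x≉0 (^-≉0 n x≉0)

  ^≈1⇒≉0 : ∀ {x n} → 1 ℕ.≤ n → x ^ n ≈ 1# → ¬ (x ≈ 0#)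
  ^≈1⇒≉0 {x} {n} 1≤n e x≈0 = 1≉0 (trans (sym e) (trans (^-cong n x≈0) (0^ 1≤n)))

  -- Polynomials as coefficient vectors, and their roots.

  horner : ∀ {n} → (Fin n → Carrier) → Carrier → Carrier
  horner {zero}  c x = 0#
  horner {suc n} c x = c zero + x * horner (c ∘ suc) x

  horner-cong : ∀ {n} {c d : Fin n → Carrier} {x y} →
                (∀ i → c i ≈ d i) → x ≈ y → horner c x ≈ horner d y
  horner-cong {zero}  _ _ = refl
  horner-cong {suc n} e x≈y = +-cong (e zero) (*-cong x≈y (horner-cong (e ∘ suc) x≈y))

  horner-zero : ∀ {n} {c : Fin n → Carrier} x → (∀ i → c i ≈ 0#) → horner c x ≈ 0#
  horner-zero {zero}  x e = refl
  horner-zero {suc n} {c} x e = begin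
    c zero + x * horner (c ∘ suc) x  ≈⟨ +-cong (e zero) (*-congˡ (horner-zero x (e ∘ suc))) ⟩
    0# + x * 0#                      ≈⟨ +-identityˡ _ ⟩
    x * 0#                           ≈⟨ zeroʳ x ⟩
    0#                               ∎

  -- Adding `v` to one coefficient adds one monomial to the value. The new vector `d` is described
  -- only up to ≈, so that the lemma also applies when the update is made before a map such as `φ`
  -- or `_· 1#`.
  horner-update : ∀ {n} {c d : Fin n → Carrier} {v} (k : Fin n) x →
                  d k ≈ v + c k → (∀ i → i ≢ k → d i ≈ c i) →
                  horner d x ≈ v * x ^ toℕ k + horner c x
  horner-update {suc n} {c} {d} {v} zero x e e′ = begin
    d zero + x * horner (d ∘ suc) x
      ≈⟨ +-cong e (*-congˡ (horner-cong (λ i → e′ (suc i) λ ()) refl)) ⟩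
    (v + c zero) + x * horner (c ∘ suc) x
      ≈⟨ +-assoc v _ _ ⟩
    v + horner c x
      ≈⟨ +-congʳ (*-identityʳ v) ⟨
    v * 1# + horner c x ∎
  horner-update {suc n} {c} {d} {v} (suc k) x e e′ = begin
    d zero + x * horner (d ∘ suc) x
      ≈⟨ +-cong (e′ zero λ ()) (*-congˡ
           (horner-update k x e λ i i≢k → e′ (suc i) (i≢k ∘ Finₚ.suc-injective))) ⟩
    c zero + x * (v * x ^ toℕ k + horner (c ∘ suc) x)
      ≈⟨ solve 5 (λ a x v y h → a :+ x :* (v :* y :+ h) := v :* (x :* y) :+ (a :+ x :* h))
           refl (c zero) x v (x ^ toℕ k) (horner (c ∘ suc) x) ⟩
    v * (x * x ^ toℕ k) + (c zero + x * horner (c ∘ suc) x) ∎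

  horner-updateAt : ∀ {n} (c : Fin n → Carrier) (k : Fin n) (f : Carrier → Carrier) v x →
                    f (c k) ≈ v + c k →
                    horner (updateAt c k f) x ≈ v * x ^ toℕ k + horner c x
  horner-updateAt c k f v x e = horner-update k x
    (trans (reflexive (updateAt-updates k {f} c)) e)
    (λ i i≢k → reflexive (updateAt-minimal i k {f} c i≢k))

  -- Synthetic division by X - a: coefficient `i` is the value at `a` of what is left of the
  -- polynomial after its lowest `i + 1` coefficients are dropped.
  quotient : ∀ {n} → (Fin (suc n) → Carrier) → Carrier → Fin n → Carrier
  quotient c a zero    = horner (c ∘ suc) a
  quotient c a (suc i) = quotient (c ∘ suc) a i

  -- f(x) − f(a) = (x − a) q(x), without subtraction.
  horner-quotient : ∀ {n} (c : Fin (suc n) → Carrier) a x →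
    horner c x + a * horner (quotient c a) x ≈ horner c a + x * horner (quotient c a) x
  horner-quotient {zero} c a x = begin
    (c zero + x * 0#) + a * 0#  ≈⟨ solve 4 (λ c x a z → (c :+ x :* z) :+ a :* z := (c :+ a :* z) :+ x :* z) refl (c zero) x a 0# ⟩
    (c zero + a * 0#) + x * 0#  ∎
  horner-quotient {suc n} c a x = begin
    (c₀ + x * fx) + a * (fa + x * q)
      ≈⟨ solve 6 (λ c x a fx fa q → (c :+ x :* fx) :+ a :* (fa :+ x :* q)
                  := (c :+ a :* fa) :+ x :* (fx :+ a :* q)) refl c₀ x a fx fa q ⟩
    (c₀ + a * fa) + x * (fx + a * q)
      ≈⟨ +-congˡ (*-congˡ (horner-quotient (c ∘ suc) a x)) ⟩
    (c₀ + a * fa) + x * (fa + x * q) ∎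
    where
    c₀ = c zero
    fx = horner (c ∘ suc) x
    fa = horner (c ∘ suc) a
    q  = horner (quotient (c ∘ suc) a) x

  -- The first coefficient of the quotient is the value at `a` of the tail of `c`, which is just the
  -- remainder hypothesis needed to recurse on that tail.
  quotient-zero : ∀ {n} (c : Fin (suc n) → Carrier) a →
                  (∀ i → quotient c a i ≈ 0#) → horner c a ≈ 0# → ∀ i → c i ≈ 0#
  quotient-zero {zero} c a _ e zero = begin
    c zero           ≈⟨ +-identityʳ _ ⟨
    c zero + 0#      ≈⟨ +-congˡ (zeroʳ a) ⟨
    c zero + a * 0#  ≈⟨ e ⟩
    0#               ∎
  quotient-zero {suc n} c a q e zero = begin
    c zero                            ≈⟨ +-identityʳ _ ⟨
    c zero + 0#                       ≈⟨ +-congˡ (zeroʳ a) ⟨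
    c zero + a * 0#                   ≈⟨ +-congˡ (*-congˡ (q zero)) ⟨
    c zero + a * horner (c ∘ suc) a   ≈⟨ e ⟩
    0#                                ∎
  quotient-zero {suc n} c a q e (suc i) = quotient-zero (c ∘ suc) a (q ∘ suc) (q zero) i

  Distinct : ∀ {n} → (Fin n → Carrier) → Set
  Distinct P = ∀ i j → P i ≈ P j → i ≡ j

  distinct-from-≤ : ∀ {n} (f : ℕ → Carrier) →
                    (∀ k l → k ℕ.≤ l → l ℕ.< n → f k ≈ f l → k ≡ l) → Distinct {n} (f ∘ toℕ)
  distinct-from-≤ f h i j e with ℕₚ.≤-total (toℕ i) (toℕ j)
  ... | inj₁ i≤j = Finₚ.toℕ-injective (h _ _ i≤j (Finₚ.toℕ<n j) e)
  ... | inj₂ j≤i = Finₚ.toℕ-injective (≡.sym (h _ _ j≤i (Finₚ.toℕ<n i) (sym e)))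

  -- Dividing out the root `P zero` leaves one coefficient fewer, and the quotient still vanishes at
  -- the other points because they differ from `P zero`.
  vanishing-coefficients : ∀ {n} (c P : Fin n → Carrier) → Distinct P →
                           (∀ j → horner c (P j) ≈ 0#) → ∀ i → c i ≈ 0#
  vanishing-coefficients {suc n} c P distinct e = quotient-zero c a
    (vanishing-coefficients (quotient c a) (P ∘ suc)
      (λ i j eq → Finₚ.suc-injective (distinct (suc i) (suc j) eq)) root)
    (e zero)
    where
    a = P zero
    root : ∀ j → horner (quotient c a) (P (suc j)) ≈ 0#
    root j = *-cancelʳ-distinct (λ eq → Finₚ.0≢1+n (distinct zero (suc j) eq)) (begin
      a * q       ≈⟨ +-identityˡ _ ⟨
      0# + a * q  ≈⟨ +-congʳ (e (suc j)) ⟨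
      horner c (P (suc j)) + a * q  ≈⟨ horner-quotient c a (P (suc j)) ⟩
      horner c a + P (suc j) * q    ≈⟨ +-congʳ (e zero) ⟩
      0# + P (suc j) * q            ≈⟨ +-identityˡ _ ⟩
      P (suc j) * q                 ∎)
      where q = horner (quotient c a) (P (suc j))

  -- X^d - 1 has `d + 1` coefficients, so `d + 1` distinct roots would force its leading coefficient
  -- 1 to be 0.
  ¬too-many-roots-of-unity : ∀ {d} → 1 ℕ.≤ d → (P : Fin (suc d) → Carrier) → Distinct P →
                             ¬ (∀ j → P j ^ d ≈ 1#)
  ¬too-many-roots-of-unity {suc d′} _ P distinct roots =
    1≉0 (trans (reflexive (≡.sym (updateAt-updates top {λ _ → 1#} linear)))
              (vanishing-coefficients poly P distinct root top))
    where
    d    = suc d′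
    top  = fromℕ d
    zeros linear poly : Fin (suc d) → Carrier
    zeros  = λ _ → 0#
    linear = updateAt zeros zero (λ _ → - 1#)
    poly   = updateAt linear top (λ _ → 1#)
    root : ∀ j → horner poly (P j) ≈ 0#
    root j = begin
      horner poly (P j)
        ≈⟨ horner-updateAt linear top (λ _ → 1#) 1# (P j) (sym (+-identityʳ 1#)) ⟩
      1# * P j ^ toℕ top + horner linear (P j)
        ≈⟨ +-cong (*-identityˡ _)
             (horner-updateAt zeros zero (λ _ → - 1#) (- 1#) (P j) (sym (+-identityʳ _))) ⟩
      P j ^ toℕ top + (- 1# * 1# + horner zeros (P j))
        ≈⟨ +-cong (trans (^-congʳ (P j) (Finₚ.toℕ-fromℕ d)) (roots j))
             (+-cong (*-identityʳ _) (horner-zero {c = zeros} (P j) λ _ → refl)) ⟩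
      1# + (- 1# + 0#)
        ≈⟨ +-congˡ (+-identityʳ _) ⟩
      1# + - 1#
        ≈⟨ -‿inverseʳ 1# ⟩
      0# ∎

-- Prime divisors of natural numbers.

prime∤⇒coprime : ∀ {r n} → Prime r → ¬ r ∣ n → Coprime n r
prime∤⇒coprime rp r∤n (d∣n , d∣r) with prime⇒irreducible rp d∣r
... | inj₁ d≡1    = d≡1
... | inj₂ ≡.refl = ⊥-elim (r∤n d∣n)

prime⇒>1 : ∀ {r} → Prime r → 2 ℕ.≤ r
prime⇒>1 {r} rp = ℕ.nonTrivial⇒n>1 r {{prime⇒nonTrivial rp}}

prime-divisor : ∀ {d} → 2 ℕ.≤ d → ∃ λ r → Prime r × r ∣ d
prime-divisor {d} 2≤d = go (factorise d {{ℕ.>-nonZero (ℕₚ.≤-trans (s≤s z≤n) 2≤d)}})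
  where
  go : PrimeFactorisation d → ∃ λ r → Prime r × r ∣ d
  go record { factors = [] ; isFactorisation = ≡.refl } = ⊥-elim (ℕₚ.<-irrefl ≡.refl 2≤d)
  go record { factors = r ∷ rs ; isFactorisation = ≡.refl ; factorsPrime = rp ∷ _ } = r , rp , m∣m*n _

split-power : ∀ {r} → 2 ℕ.≤ r → ∀ d → 1 ℕ.≤ d →
              ∃₂ λ e m → d ≡ r ℕ.^ e ℕ.* m × ¬ r ∣ m
split-power {r} 2≤r = <-rec _ step
  where
  step : ∀ d → (∀ {d′} → d′ ℕ.< d → 1 ℕ.≤ d′ → ∃₂ λ e m → d′ ≡ r ℕ.^ e ℕ.* m × ¬ r ∣ m) →
         1 ℕ.≤ d → ∃₂ λ e m → d ≡ r ℕ.^ e ℕ.* m × ¬ r ∣ m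
  step d rec 1≤d with r ∣? d
  ... | no r∤d = 0 , d , ≡.sym (ℕₚ.*-identityˡ d) , r∤d
  ... | yes (divides (suc q) ≡.refl) with rec (ℕₚ.m<m*n (suc q) r 2≤r) (s≤s z≤n)
  ...   | e , m , eq , r∤m = suc e , m ,
    ≡.trans (≡.cong (ℕ._* r) eq) (≡.trans (ℕₚ.*-comm _ r) (≡.sym (ℕₚ.*-assoc r _ m))) , r∤m
  step d rec () | yes (divides zero ≡.refl)

-- The multiplicative group of a finite field.

module FiniteFieldTheory (F : FiniteField) where

  open FieldTheory F public
  open SetoidReasoning setoid
  open NatSolver commutativeSemiring using (solve; _:=_; _:*_)

  units : ℕ
  units = ℕ.pred size

  size≡1+units : size ≡ suc units
  size≡1+units = go size (proj₁ (enum-surj 0#))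
    where
    go : ∀ n → Fin n → n ≡ suc (ℕ.pred n)
    go (suc n) _ = ≡.refl

  -- Reindexing by a successor allows the index of 0 to be punched out, which leaves an enumeration
  -- of the units.
  elt : Fin (suc units) → Carrier
  elt i = enum (cast (≡.sym size≡1+units) i)

  index : Carrier → Fin (suc units)
  index x = cast size≡1+units (proj₁ (enum-surj x))

  elt-index : ∀ x → elt (index x) ≈ x
  elt-index x = trans (reflexive (≡.cong enum (Finₚ.cast-involutive (≡.sym size≡1+units) size≡1+units (proj₁ (enum-surj x))))) (proj₂ (enum-surj x))

  elt-injective : ∀ i j → elt i ≈ elt j → i ≡ j
  elt-injective i j e = Finₚ.toℕ-injective (≡.trans (≡.sym (Finₚ.toℕ-cast _ i))
    (≡.trans (≡.cong toℕ (enum-inj _ _ e)) (Finₚ.toℕ-cast _ j)))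

  -- Turns ≈ into ≡, so anything defined through `index` is automatically independent of
  -- representatives.
  index-cong : ∀ {x y} → x ≈ y → index x ≡ index y
  index-cong {x} {y} e = elt-injective _ _ (trans (elt-index x) (trans e (sym (elt-index y))))

  index-elt : ∀ i → index (elt i) ≡ i
  index-elt i = elt-injective _ _ (elt-index (elt i))

  unit : Fin units → Carrier
  unit j = elt (punchIn (index 0#) j)

  unit-distinct : Distinct unit
  unit-distinct i j e = Finₚ.punchIn-injective (index 0#) i j (elt-injective _ _ e)

  unit≉0 : ∀ j → ¬ (unit j ≈ 0#)
  unit≉0 j e = Finₚ.punchInᵢ≢i (index 0#) j
    (≡.trans (≡.sym (index-elt _)) (index-cong e))

  unitIndex : ∀ x → ¬ (x ≈ 0#) → Fin units
  unitIndex x x≉0 = punchOut {i = index 0#} {j = index x} λ e →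
    x≉0 (trans (sym (elt-index x)) (trans (reflexive (≡.cong elt (≡.sym e))) (elt-index 0#)))

  unit-unitIndex : ∀ x (x≉0 : ¬ (x ≈ 0#)) → unit (unitIndex x x≉0) ≈ x
  unit-unitIndex x x≉0 = trans (reflexive (≡.cong elt (Finₚ.punchIn-punchOut _))) (elt-index x)

  1≤units : 1 ℕ.≤ units
  1≤units = go units (unitIndex 1# 1≉0)
    where
    go : ∀ n → Fin n → 1 ℕ.≤ n
    go (suc n) _ = s≤s z≤n

  module _ where
    open MonoidSum *-commutativeMonoid
      renaming (sum to product)

    product-≉0 : ∀ {n} (f : Fin n → Carrier) → (∀ i → ¬ (f i ≈ 0#)) → ¬ (product f ≈ 0#)
    product-≉0 {zero}  f _ = 1≉0
    product-≉0 {suc n} f h = *-≉0 (h zero) (product-≉0 (f ∘ suc) (h ∘ suc))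

    product-scale : ∀ {n} x (f : Fin n → Carrier) → product (λ i → x * f i) ≈ x ^ n * product f
    product-scale {zero}  x f = sym (*-identityˡ 1#)
    product-scale {suc n} x f = trans (*-congˡ (product-scale x (f ∘ suc)))
      (solve 4 (λ x a y b → (x :* a) :* (y :* b) := (x :* y) :* (a :* b)) refl x (f zero) (x ^ n) (product (f ∘ suc)))

    -- Multiplication by `x` permutes the units, with multiplication by its inverse as the inverse
    -- permutation. Hence the product of all units equals itself times x^units, and it can be
    -- cancelled.
    fermat : ∀ x → ¬ (x ≈ 0#) → x ^ units ≈ 1#
    fermat x x≉0 with inverse x x≉0
    ... | y , xy≈1 = sym (*-cancelˡ (product-≉0 unit unit≉0) (begin
      product unit * 1#              ≈⟨ *-identityʳ _ ⟩
      product unit                   ≈⟨ sum-permute unit π ⟩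
      product (unit ∘ (π ⟨$⟩ʳ_))     ≈⟨ sum-cong-≋ {units} (λ j → unit-unitIndex (x * unit j) (*-≉0 x≉0 (unit≉0 j))) ⟩
      product (λ j → x * unit j)     ≈⟨ product-scale x unit ⟩
      x ^ units * product unit       ≈⟨ *-comm _ _ ⟩
      product unit * x ^ units       ∎))
      where
      y≉0 : ¬ (y ≈ 0#)
      y≉0 y≈0 = 1≉0 (trans (sym xy≈1) (trans (*-congˡ y≈0) (zeroʳ x)))
      mul : ∀ z → ¬ (z ≈ 0#) → Fin units → Fin units
      mul z z≉0 j = unitIndex (z * unit j) (*-≉0 z≉0 (unit≉0 j))
      mul-mul : ∀ z w z≉0 w≉0 → z * w ≈ 1# → ∀ j → mul z z≉0 (mul w w≉0 j) ≡ j
      mul-mul z w z≉0 w≉0 e j = unit-distinct _ _ (begin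
        unit (mul z z≉0 (mul w w≉0 j))  ≈⟨ unit-unitIndex _ (*-≉0 z≉0 (unit≉0 (mul w w≉0 j))) ⟩
        z * unit (mul w w≉0 j)          ≈⟨ *-congˡ (unit-unitIndex _ (*-≉0 w≉0 (unit≉0 j))) ⟩
        z * (w * unit j)                ≈⟨ *-assoc z w _ ⟨
        z * w * unit j                  ≈⟨ *-congʳ e ⟩
        1# * unit j                     ≈⟨ *-identityˡ _ ⟩
        unit j                          ∎)
      π : Permutation units units
      π = permutation (mul x x≉0) (mul y y≉0)
            (mul-mul x y x≉0 y≉0 xy≈1) (mul-mul y x y≉0 x≉0 (trans (*-comm y x) xy≈1))

  ^size : ∀ x → x ^ size ≈ x
  ^size x = trans (^-congʳ x size≡1+units) (go (x ≟ 0#))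
    where
    go : Dec (x ≈ 0#) → x * x ^ units ≈ x
    go (yes x≈0) = trans (*-congʳ x≈0) (trans (zeroˡ _) (sym x≈0))
    go (no x≉0)  = trans (*-congˡ (fermat x x≉0)) (*-identityʳ x)

  -- The additive twin of `fermat`: translation by 1 permutes the field, which adds `size · 1#` to
  -- the sum of all elements without changing it.
  size·1≈0 : size · 1# ≈ 0#
  size·1≈0 = trans (reflexive (≡.cong (_· 1#) size≡1+units))
    (+-identityˡ-unique _ (sum elt) (sym (begin
      sum elt                             ≈⟨ sum-permute elt π ⟩
      sum (λ i → elt (shift 1# i))        ≈⟨ sum-cong-≋ {suc units} (λ i → elt-index (1# + elt i)) ⟩
      sum (λ i → 1# + elt i)              ≈⟨ ∑-distrib-+ (λ _ → 1#) elt ⟩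
      sum {suc units} (λ _ → 1#) + sum elt ≈⟨ +-congʳ (sum-replicate (suc units)) ⟩
      suc units · 1# + sum elt            ∎)))
    where
    open MonoidSum +-commutativeMonoid
    shift : Carrier → Fin (suc units) → Fin (suc units)
    shift z i = index (z + elt i)
    shift-shift : ∀ z w → z + w ≈ 0# → ∀ i → shift z (shift w i) ≡ i
    shift-shift z w e i = elt-injective _ _ (begin
      elt (shift z (shift w i))  ≈⟨ elt-index _ ⟩
      z + elt (shift w i)        ≈⟨ +-congˡ (elt-index _) ⟩
      z + (w + elt i)            ≈⟨ +-assoc z w _ ⟨
      z + w + elt i              ≈⟨ +-congʳ e ⟩
      0# + elt i                 ≈⟨ +-identityˡ _ ⟩
      elt i                      ∎)
    π : Permutation (suc units) (suc units)
    π = permutation (shift 1#) (shift (- 1#))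
          (shift-shift 1# (- 1#) (-‿inverseʳ 1#)) (shift-shift (- 1#) 1# (-‿inverseˡ 1#))

  HasOrder : Carrier → ℕ → Set
  HasOrder x d = x ^ d ≈ 1# × (∀ n → x ^ n ≈ 1# → d ∣ n)

  ^-coprime : ∀ {x m n} → Coprime m n → x ^ m ≈ 1# → x ^ n ≈ 1# → x ≈ 1#
  ^-coprime {x} {m} {n} coprime em en with coprime-Bézout coprime
  ... | Bézout.+- a b eq = begin
    x                     ≈⟨ *-identityʳ x ⟨
    x * 1#                ≈⟨ *-congˡ (^≈1-multiple b en) ⟨
    x ^ (1 ℕ.+ b ℕ.* n)   ≈⟨ ^-congʳ x eq ⟩
    x ^ (a ℕ.* m)         ≈⟨ ^≈1-multiple a em ⟩
    1#                    ∎
  ... | Bézout.-+ a b eq = begin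
    x                     ≈⟨ *-identityʳ x ⟨
    x * 1#                ≈⟨ *-congˡ (^≈1-multiple a em) ⟨
    x ^ (1 ℕ.+ a ℕ.* m)   ≈⟨ ^-congʳ x eq ⟩
    x ^ (b ℕ.* n)         ≈⟨ ^≈1-multiple b en ⟩
    1#                    ∎

  -- If r did not divide n, then x^(r^e) would be killed by the coprime exponents n and r, hence be
  -- 1. Otherwise x^r and n / r replace x and n, and e drops by one.
  prime-power∣ : ∀ {r} → Prime r → ∀ e {x n} → x ^ (r ℕ.^ suc e) ≈ 1# → ¬ (x ^ (r ℕ.^ e) ≈ 1#) →
                 x ^ n ≈ 1# → r ℕ.^ suc e ∣ n
  prime-power∣ {r} rp e {x} {n} h h′ hn with r ∣? n
  ... | no r∤n = ⊥-elim (h′ (^-coprime (prime∤⇒coprime rp r∤n)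
    (begin
      (x ^ (r ℕ.^ e)) ^ n  ≈⟨ ^-swap x (r ℕ.^ e) n ⟩
      (x ^ n) ^ (r ℕ.^ e)  ≈⟨ ^-cong (r ℕ.^ e) hn ⟩
      1# ^ (r ℕ.^ e)       ≈⟨ 1^ (r ℕ.^ e) ⟩
      1#                   ∎)
    (trans (^-* x (r ℕ.^ e) r) (trans (^-congʳ x (ℕₚ.*-comm (r ℕ.^ e) r)) h))))
  prime-power∣ {r} rp zero    h h′ hn | yes r∣n = ≡.subst (_∣ _) (≡.sym (ℕₚ.*-identityʳ r)) r∣n
  prime-power∣ {r} rp (suc e) {x} {n} h h′ hn | yes (divides n′ ≡.refl) =
    ≡.subst (_∣ n′ ℕ.* r) (ℕₚ.*-comm (r ℕ.^ suc e) r) (*-monoˡ-∣ r (prime-power∣ rp e {x ^ r} {n′}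
      (trans (^-* x r _) h)
      (λ h″ → h′ (trans (sym (^-* x r _)) h″))
      (trans (^-* x r n′) (trans (^-congʳ x (ℕₚ.*-comm r n′)) hn))))

  -- Raising (x y)^n = 1 to the power e removes y, so d divides e n and hence n; symmetrically e
  -- divides n.
  order-product : ∀ {x y d e} → HasOrder x d → HasOrder y e → Coprime d e →
                  HasOrder (x * y) (d ℕ.* e)
  order-product {x} {y} {d} {e} (xd , x∣) (ye , y∣) coprime =
    (begin
      (x * y) ^ (d ℕ.* e)              ≈⟨ ^-distrib-* x y (d ℕ.* e) ⟩
      x ^ (d ℕ.* e) * y ^ (d ℕ.* e)    ≈⟨ *-cong (trans (^-congʳ x (ℕₚ.*-comm d e)) (^≈1-multiple e xd)) (^≈1-multiple d ye) ⟩
      1# * 1#                          ≈⟨ *-identityˡ 1# ⟩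
      1#                               ∎) ,
    λ n h → divisor n
      (coprime-divisor coprime (x∣ (e ℕ.* n) (begin
        x ^ (e ℕ.* n)                     ≈⟨ *-identityʳ _ ⟨
        x ^ (e ℕ.* n) * 1#                ≈⟨ *-congˡ (trans (^-congʳ y (ℕₚ.*-comm e n)) (^≈1-multiple n ye)) ⟨
        x ^ (e ℕ.* n) * y ^ (e ℕ.* n)     ≈⟨ ^-distrib-* x y (e ℕ.* n) ⟨
        (x * y) ^ (e ℕ.* n)               ≈⟨ ^≈1-multiple e h ⟩
        1#                                ∎)))
      (coprime-divisor (Coprimality.sym coprime) (y∣ (d ℕ.* n) (begin
        y ^ (d ℕ.* n)                     ≈⟨ *-identityˡ _ ⟨
        1# * y ^ (d ℕ.* n)                ≈⟨ *-congʳ (trans (^-congʳ x (ℕₚ.*-comm d n)) (^≈1-multiple n xd)) ⟨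
        x ^ (d ℕ.* n) * y ^ (d ℕ.* n)     ≈⟨ ^-distrib-* x y (d ℕ.* n) ⟨
        (x * y) ^ (d ℕ.* n)               ≈⟨ ^≈1-multiple d h ⟩
        1#                                ∎)))
    where
    divisor : ∀ n → d ∣ n → e ∣ n → d ℕ.* e ∣ n
    divisor n d∣n (divides k ≡.refl) =
      *-monoˡ-∣ e (coprime-divisor coprime (≡.subst (d ∣_) (ℕₚ.*-comm k e) d∣n))

  order-^ : ∀ {x} k m → 1 ℕ.≤ k → HasOrder x (k ℕ.* m) → HasOrder (x ^ k) m
  order-^ {x} k m 1≤k (h , x∣) = trans (^-* x k m) h ,
    λ n e → *-cancelˡ-∣ k {{ℕ.>-nonZero 1≤k}} (x∣ (k ℕ.* n) (trans (sym (^-* x k n)) e))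

  ∃-unit-^≉1 : ∀ {m} → 1 ℕ.≤ m → m ℕ.< units → ∃ λ x → ¬ (x ≈ 0#) × ¬ (x ^ m ≈ 1#)
  ∃-unit-^≉1 {m} 1≤m m<units with Finₚ.any? (λ j → ¬? (unit j ^ m ≟ 1#))
  ... | yes (j , h) = unit j , unit≉0 j , h
  ... | no ¬h = ⊥-elim (¬too-many-roots-of-unity 1≤m (λ j → unit (inject≤ j m<units))
    (λ i j e → Finₚ.inject≤-injective m<units m<units i j (unit-distinct _ _ e))
    (λ j → decidable-stable (_ ≟ _) λ h → ¬h (_ , h)))

  -- Let k = units / r^(e+1). Since k r^e = units / r is smaller than `units`, some unit x has x^(k
  -- r^e) ≠ 1, and then x^k has order exactly r^(e+1).
  ∃-prime-power-order : ∀ {r} → Prime r → ∀ e → r ℕ.^ suc e ∣ units → ∃ λ x → HasOrder x (r ℕ.^ suc e)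
  ∃-prime-power-order {r} rp e (divides k eq) with
    ∃-unit-^≉1 {k ℕ.* r ℕ.^ e} 1≤m (≡.subst (k ℕ.* r ℕ.^ e ℕ.<_) (≡.sym eq′)
      (ℕₚ.m<m*n (k ℕ.* r ℕ.^ e) r {{ℕ.>-nonZero 1≤m}} (prime⇒>1 rp)))
    where
    eq′ : units ≡ k ℕ.* r ℕ.^ e ℕ.* r
    eq′ = ≡.trans eq (≡.trans (≡.cong (k ℕ.*_) (ℕₚ.*-comm r _)) (≡.sym (ℕₚ.*-assoc k _ r)))
    1≤m : 1 ℕ.≤ k ℕ.* r ℕ.^ e
    1≤m = ℕₚ.n≢0⇒n>0 λ m≡0 → ℕₚ.<⇒≢ 1≤units (≡.sym (≡.trans eq′ (≡.cong (ℕ._* r) m≡0)))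
  ... | x , x≉0 , h = x ^ k , y^ , λ n → prime-power∣ rp e {x ^ k} {n} y^ (λ e′ → h (trans (sym (^-* x k _)) e′))
    where
    y^ : (x ^ k) ^ (r ℕ.^ suc e) ≈ 1#
    y^ = trans (^-* x k _) (trans (^-congʳ x (≡.sym eq)) (fermat x x≉0))

  -- Splits off the full power of one prime from d and multiplies elements of coprime orders. The
  -- case d = units says that the group of units is cyclic.
  ∃-order : ∀ d → 1 ℕ.≤ d → d ∣ units → ∃ λ x → HasOrder x d
  ∃-order = <-rec _ step
    where
    step : ∀ d → (∀ {d′} → d′ ℕ.< d → 1 ℕ.≤ d′ → d′ ∣ units → ∃ λ x → HasOrder x d′) →
           1 ℕ.≤ d → d ∣ units → ∃ λ x → HasOrder x d
    step 1 rec _ _ = 1# , 1^ 1 , λ n _ → 1∣ n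
    step d@(suc (suc _)) rec _ d∣u with prime-divisor {d} (s≤s (s≤s z≤n))
    ... | r , rp , r∣d with split-power (prime⇒>1 rp) d (s≤s z≤n)
    ...   | zero , m , eq , r∤m = ⊥-elim (r∤m (≡.subst (r ∣_) (≡.trans eq (ℕₚ.*-identityˡ m)) r∣d))
    ...   | suc e , zero , eq , r∤m = ⊥-elim (r∤m (divides 0 ≡.refl))
    ...   | suc e , m@(suc _) , eq , r∤m =
      let x , ox = ∃-prime-power-order rp e (∣-trans (≡.subst (r ℕ.^ suc e ∣_) (≡.sym eq) (m∣m*n m)) d∣u)
          y , oy = rec (≡.subst (m ℕ.<_) (≡.sym eq) m<) (s≤s z≤n)
                       (∣-trans (≡.subst (m ∣_) (≡.sym eq) (n∣m*n (r ℕ.^ suc e))) d∣u)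
      in x * y , ≡.subst (HasOrder (x * y)) (≡.sym eq) (order-product ox oy (coprime-^ (suc e)))
      where
      m< : m ℕ.< r ℕ.^ suc e ℕ.* m
      m< = ≡.subst (m ℕ.<_) (ℕₚ.*-comm m _) (ℕₚ.m<m*n m (r ℕ.^ suc e)
             (ℕₚ.≤-trans (prime⇒>1 rp) (ℕₚ.m≤m*n r (r ℕ.^ e) {{ℕₚ.m^n≢0 r e {{prime⇒nonZero rp}}}})))
      coprime-* : ∀ {a b c} → Coprime a c → Coprime b c → Coprime (a ℕ.* b) c
      coprime-* {a} {b} {c} ac bc {d} (d∣ab , d∣c) = bc
        (coprime-divisor (λ (i , j) → ac (j , ∣-trans i d∣c)) d∣ab , d∣c)
      coprime-^ : ∀ k → Coprime (r ℕ.^ k) m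
      coprime-^ zero    = Coprimality.1-coprimeTo m
      coprime-^ (suc k) = coprime-* (Coprimality.sym (prime∤⇒coprime rp r∤m)) (coprime-^ k)

  abstract
    generator : ∃ λ g → HasOrder g units
    generator = ∃-order units 1≤units ∣-refl

  ^-injective-≤ : ∀ {x d} → HasOrder x d → ∀ m n → m ℕ.≤ n → n ℕ.< d → x ^ m ≈ x ^ n → m ≡ n
  ^-injective-≤ {x} {d} (xd , x∣) m n m≤n n<d e with ℕₚ.m≤n⇒∃[o]m+o≡n m≤n
  ... | zero  , ≡.refl = ≡.sym (ℕₚ.+-identityʳ m)
  ... | suc o , ≡.refl = ⊥-elim (ℕₚ.<⇒≱ (ℕₚ.≤-<-trans (ℕₚ.m≤n+m (suc o) m) n<d)
    (∣⇒≤ (x∣ (suc o) (sym (*-cancelˡ (^-≉0 m (^≈1⇒≉0 (ℕₚ.≤-<-trans z≤n n<d) xd))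
      (trans (*-identityʳ _) (trans e (^-+ x m (suc o)))))))))

  powers-distinct : ∀ {x d} → HasOrder x d → Distinct {d} (λ i → x ^ toℕ i)
  powers-distinct {x} o = distinct-from-≤ (x ^_) (^-injective-≤ o)

  -- A root `z` outside the `d` distinct powers of `x` would be one root of X^d - 1 too many.
  root-of-unity-is-power : ∀ {x d} → 1 ℕ.≤ d → HasOrder x d → ∀ z → z ^ d ≈ 1# →
                           ∃ λ n → z ≈ x ^ n
  root-of-unity-is-power {x} {d} 1≤d o z zd with Finₚ.any? (λ (i : Fin d) → z ≟ x ^ toℕ i)
  ... | yes (i , e) = toℕ i , e
  ... | no ¬h = ⊥-elim (¬too-many-roots-of-unity 1≤d P distinct roots)
    where
    P : Fin (suc d) → Carrier
    P zero    = z
    P (suc i) = x ^ toℕ i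
    distinct : Distinct P
    distinct zero    zero    _ = ≡.refl
    distinct zero    (suc j) e = ⊥-elim (¬h (j , e))
    distinct (suc i) zero    e = ⊥-elim (¬h (i , sym e))
    distinct (suc i) (suc j) e = ≡.cong suc (powers-distinct o i j e)
    roots : ∀ j → P j ^ d ≈ 1#
    roots zero    = zd
    roots (suc i) = trans (^-swap x (toℕ i) d) (trans (^-cong (toℕ i) (proj₁ o)) (1^ (toℕ i)))

  root-of-unity⇒power : ∀ {k d} → k ℕ.* d ≡ units → ∀ {z} → z ^ d ≈ 1# → ∃ λ x → x ^ k ≈ z
  root-of-unity⇒power {k} {d} eq {z} zd =
    let g , o    = generator
        1≤k      = ℕₚ.n≢0⇒n>0 λ { ≡.refl → ℕₚ.<⇒≢ 1≤units eq }
        1≤d      = ℕₚ.n≢0⇒n>0 λ { ≡.refl → ℕₚ.<⇒≢ 1≤units (≡.trans (≡.sym (ℕₚ.*-zeroʳ k)) eq) }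
        n , e    = root-of-unity-is-power 1≤d (order-^ k d 1≤k (≡.subst (HasOrder g) (≡.sym eq) o)) z zd
    in g ^ n , trans (^-swap g n k) (sym e)

  power⇒root-of-unity : ∀ {k d} → k ℕ.* d ≡ units → ∀ {x} → ¬ (x ≈ 0#) → (x ^ k) ^ d ≈ 1#
  power⇒root-of-unity {k} {d} eq {x} x≉0 = trans (^-* x k d) (trans (^-congʳ x eq) (fermat x x≉0))

  -- The bridge from fixed points of a power map to divisors of p^t - 1, where primitivity can be
  -- applied.
  order∣pred : ∀ {x d n} → 1 ℕ.≤ d → HasOrder x d → 1 ℕ.≤ n → x ^ n ≈ x → d ∣ n ℕ.∸ 1
  order∣pred {x} {d} {suc n} 1≤d (xd , x∣) _ e =
    x∣ n (*-cancelˡ (^≈1⇒≉0 1≤d xd) (trans e (sym (*-identityʳ x))))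

-- Binomial coefficients modulo a prime, and codes of vectors.

prime∤! : ∀ {p} → Prime p → ∀ k → k ℕ.< p → ¬ p ∣ k ℕ.!
prime∤! pp zero    _   p∣1 = ℕₚ.<⇒≱ (prime⇒>1 pp) (∣⇒≤ p∣1)
prime∤! pp (suc k) k<p p∣ with euclidsLemma (suc k) (k ℕ.!) pp p∣
... | inj₁ p∣k = ℕₚ.<⇒≱ k<p (∣⇒≤ p∣k)
... | inj₂ p∣k! = prime∤! pp k (ℕₚ.<⇒≤ k<p) p∣k!

-- p divides p! = C(p,k) · k! (p - k)!, but neither of the two factorials.
prime∣binomial : ∀ {p} → Prime p → ∀ {k} → 1 ℕ.≤ k → k ℕ.< p → p ∣ p C k
prime∣binomial {p@(suc p-1)} pp {k@(suc k-1)} _ k<p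
  with euclidsLemma (p C k) (k ℕ.! ℕ.* (p ℕ.∸ k) ℕ.!) pp
         (≡.subst (p ∣_) (≡.sym eq) (m∣m*n (p-1 ℕ.!)))
  where
  instance
    _ = k ℕₚ.!* (p ℕ.∸ k) !≢0
  eq : (p C k) ℕ.* (k ℕ.! ℕ.* (p ℕ.∸ k) ℕ.!) ≡ p ℕ.!
  eq = ≡.trans (≡.cong (ℕ._* (k ℕ.! ℕ.* (p ℕ.∸ k) ℕ.!)) (nCk≡n!/k![n-k]! (ℕₚ.<⇒≤ k<p)))
               (m/n*n≡m (k![n∸k]!∣n! (ℕₚ.<⇒≤ k<p)))
... | inj₁ p∣C = p∣C
... | inj₂ p∣kl with euclidsLemma (k ℕ.!) ((p ℕ.∸ k) ℕ.!) pp p∣kl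
...   | inj₁ p∣k! = ⊥-elim (prime∤! pp k k<p p∣k!)
...   | inj₂ p∣l! = ⊥-elim (prime∤! pp (p ℕ.∸ k) (s≤s (ℕₚ.m∸n≤m p-1 k-1)) p∣l!)

-- Coefficient vectors are counted through their codes in `Fin (m ^ n)`; vectors that agree
-- pointwise have equal codes, without function extensionality.
finToFun-injective : ∀ {m n} (i j : Fin (m ℕ.^ n)) →
                     (∀ k → finToFun {m} {n} i k ≡ finToFun {m} {n} j k) → i ≡ j
finToFun-injective {m} {n} i j e = ≡.trans (≡.sym (Finₚ.funToFin-finToFin {n} {m} i))
  (≡.trans (funToFin-cong {f = finToFun i} {g = finToFun j} e) (Finₚ.funToFin-finToFin {n} {m} j))
  where
  funToFin-cong : ∀ {n} {f g : Fin n → Fin m} → (∀ k → f k ≡ g k) → funToFin f ≡ funToFin g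
  funToFin-cong {zero}  e = ≡.refl
  funToFin-cong {suc n} e = ≡.cong₂ combine (e zero) (funToFin-cong (e ∘ suc))

-- Independence of powers, and spanning by counting.

module SpanTheory (F : FiniteField) where

  open FiniteFieldTheory F public
  open SetoidReasoning setoid
  open NatSolver commutativeSemiring using (solve; _:=_; _:+_; _:*_)

  distinct⇒surjective : ∀ {n} → size ≡ n → (P : Fin n → Carrier) → Distinct P →
                        ∀ z → ∃ λ i → P i ≈ z
  distinct⇒surjective {n} eq P distinct z with Finₚ.any? (λ i → P i ≟ z)
  ... | yes h = h
  ... | no ¬h = ⊥-elim (ℕₚ.1+n≰n (≡.subst (suc n ℕ.≤_) (≡.trans (≡.sym size≡1+units) eq)
      (Finₚ.injective⇒≤ {f = index ∘ Q} λ {i} {j} e → distinct′ i j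
        (trans (sym (elt-index (Q i))) (trans (reflexive (≡.cong elt e)) (elt-index (Q j)))))))
    where
    Q : Fin (suc n) → Carrier
    Q zero    = z
    Q (suc i) = P i
    distinct′ : Distinct Q
    distinct′ zero    zero    _ = ≡.refl
    distinct′ zero    (suc j) e = ⊥-elim (¬h (j , sym e))
    distinct′ (suc i) zero    e = ⊥-elim (¬h (i , e))
    distinct′ (suc i) (suc j) e = ≡.cong suc (distinct i j e)

  horner-minus : ∀ {n} (c d : Fin n → Carrier) x →
                 horner (λ i → c i - d i) x + horner d x ≈ horner c x
  horner-minus {zero}  c d x = +-identityˡ 0#
  horner-minus {suc n} c d x = begin
    (c zero - d zero + x * h) + (d zero + x * hd)
      ≈⟨ solve 6 (λ c d d′ x h hd → (c :+ d′ :+ x :* h) :+ (d :+ x :* hd) := (c :+ (d′ :+ d)) :+ x :* (h :+ hd))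
           refl (c zero) (d zero) (- d zero) x h hd ⟩
    (c zero + (- d zero + d zero)) + x * (h + hd)
      ≈⟨ +-cong (trans (+-congˡ (-‿inverseˡ (d zero))) (+-identityʳ _)) (*-congˡ (horner-minus (c ∘ suc) (d ∘ suc) x)) ⟩
    c zero + x * horner (c ∘ suc) x ∎
    where
    h  = horner (λ i → c (suc i) - d (suc i)) x
    hd = horner (d ∘ suc) x

  -- Isolating this property lets one argument serve twice: with r = p for `F₁` over the prime
  -- field, and with r = p^a for `F₂` over the field of p^a elements.
  AdditivePower : ℕ → Set
  AdditivePower r = ∀ x y → (x + y) ^ r ≈ x ^ r + y ^ r

  additive-^ : ∀ {r} → AdditivePower r → ∀ n → AdditivePower (r ℕ.^ n)
  additive-^ {r} add zero    x y = trans (*-identityʳ _) (sym (+-cong (*-identityʳ x) (*-identityʳ y)))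
  additive-^ {r} add (suc n) x y = begin
    (x + y) ^ (r ℕ.* r ℕ.^ n)                        ≈⟨ ^-* (x + y) r _ ⟨
    ((x + y) ^ r) ^ (r ℕ.^ n)                        ≈⟨ ^-cong (r ℕ.^ n) (add x y) ⟩
    (x ^ r + y ^ r) ^ (r ℕ.^ n)                      ≈⟨ additive-^ add n (x ^ r) (y ^ r) ⟩
    (x ^ r) ^ (r ℕ.^ n) + (y ^ r) ^ (r ℕ.^ n)        ≈⟨ +-cong (^-* x r _) (^-* y r _) ⟩
    x ^ (r ℕ.* r ℕ.^ n) + y ^ (r ℕ.* r ℕ.^ n)        ∎

  -- The conjugates ω^(rʲ), j < n, of ω are distinct, and a polynomial whose coefficients are fixed by
  -- x ↦ x^r vanishes at all of them as soon as it vanishes at ω.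
  module Span (r n : ℕ) (1≤r : 1 ℕ.≤ r) (add : AdditivePower r) (size≡r^n : size ≡ r ℕ.^ n)
              (ω : Carrier) (moved : ∀ t → 1 ℕ.≤ t → t ℕ.< n → ¬ (ω ^ (r ℕ.^ t) ≈ ω)) where

    conjugate : ℕ → Carrier
    conjugate j = ω ^ (r ℕ.^ j)

    conjugate-+ : ∀ i j → conjugate i ^ (r ℕ.^ j) ≈ conjugate (i ℕ.+ j)
    conjugate-+ i j = trans (^-* ω (r ℕ.^ i) (r ℕ.^ j)) (^-congʳ ω (≡.sym (ℕₚ.^-distribˡ-+-* r i j)))

    conjugate-n : conjugate n ≈ ω
    conjugate-n = trans (^-congʳ ω (≡.sym size≡r^n)) (^size ω)

    -- Conjugation is cyclic of period n. Raising an equality of conjugates i and i + o to the power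
    -- r^(n-i) turns the left side into ω and the right side into conjugate o, so ω would not be
    -- moved.
    conjugate-injective-≤ : ∀ i j → i ℕ.≤ j → j ℕ.< n → conjugate i ≈ conjugate j → i ≡ j
    conjugate-injective-≤ i j i≤j j<n e with ℕₚ.m≤n⇒∃[o]m+o≡n i≤j
    ... | zero  , ≡.refl = ≡.sym (ℕₚ.+-identityʳ i)
    ... | suc o , ≡.refl with ℕₚ.m≤n⇒∃[o]m+o≡n (ℕₚ.≤-trans i≤j (ℕₚ.<⇒≤ j<n))
    ...   | k , i+k≡n = ⊥-elim (moved (suc o) (s≤s z≤n) (ℕₚ.≤-<-trans (ℕₚ.m≤n+m (suc o) i) j<n) (begin
      conjugate (suc o)                     ≈⟨ ^-cong (r ℕ.^ suc o) conjugate-n ⟨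
      conjugate n ^ (r ℕ.^ suc o)           ≈⟨ conjugate-+ n (suc o) ⟩
      conjugate (n ℕ.+ suc o)               ≡⟨ ≡.cong conjugate eq ⟩
      conjugate (i ℕ.+ suc o ℕ.+ k)         ≈⟨ conjugate-+ (i ℕ.+ suc o) k ⟨
      conjugate (i ℕ.+ suc o) ^ (r ℕ.^ k)   ≈⟨ ^-cong (r ℕ.^ k) e ⟨
      conjugate i ^ (r ℕ.^ k)               ≈⟨ conjugate-+ i k ⟩
      conjugate (i ℕ.+ k)                   ≡⟨ ≡.cong conjugate i+k≡n ⟩
      conjugate n                           ≈⟨ conjugate-n ⟩
      ω                                     ∎))
      where
      eq : n ℕ.+ suc o ≡ i ℕ.+ suc o ℕ.+ k
      eq = ≡.trans (≡.cong (ℕ._+ suc o) (≡.sym i+k≡n)) (≡.trans (ℕₚ.+-assoc i k (suc o))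
        (≡.trans (≡.cong (i ℕ.+_) (ℕₚ.+-comm k (suc o))) (≡.sym (ℕₚ.+-assoc i (suc o) k))))

    conjugates-distinct : Distinct {n} (conjugate ∘ toℕ)
    conjugates-distinct = distinct-from-≤ conjugate conjugate-injective-≤

    -- The fixed points of x ↦ x^r stand for the subfield of coefficients, which is never formed as
    -- a field of its own.
    Fixed : Carrier → Set
    Fixed x = x ^ r ≈ x

    fixed-minus : ∀ {x y} → Fixed x → Fixed y → Fixed (x - y)
    fixed-minus {x} {y} fx fy = trans (add x (- y)) (+-cong fx (begin
      -- Additivity gives (-y)^r = -(y^r) with no distinction between odd and even r.
      (- y) ^ r                      ≈⟨ +-inverseʳ-unique (y ^ r) ((- y) ^ r) (begin
        y ^ r + (- y) ^ r              ≈⟨ add y (- y) ⟨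
        (y - y) ^ r                    ≈⟨ ^-cong r (-‿inverseʳ y) ⟩
        0# ^ r                         ≈⟨ 0^ 1≤r ⟩
        0#                             ∎) ⟩
      - (y ^ r)                      ≈⟨ -‿cong fy ⟩
      - y                            ∎))

    horner-^ : ∀ {k} {c : Fin k → Carrier} → (∀ i → Fixed (c i)) → ∀ x →
               horner c x ^ r ≈ horner c (x ^ r)
    horner-^ {zero}  fixed x = 0^ 1≤r
    horner-^ {suc k} {c} fixed x = begin
      (c zero + x * horner (c ∘ suc) x) ^ r            ≈⟨ add _ _ ⟩
      c zero ^ r + (x * horner (c ∘ suc) x) ^ r        ≈⟨ +-cong (fixed zero) (^-distrib-* x _ r) ⟩
      c zero + x ^ r * horner (c ∘ suc) x ^ r          ≈⟨ +-congˡ (*-congˡ (horner-^ (fixed ∘ suc) x)) ⟩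
      c zero + x ^ r * horner (c ∘ suc) (x ^ r)        ∎

    independent : ∀ {c : Fin n → Carrier} → (∀ i → Fixed (c i)) → horner c ω ≈ 0# → ∀ i → c i ≈ 0#
    independent {c} fixed e = vanishing-coefficients c (conjugate ∘ toℕ) conjugates-distinct (vanish ∘ toℕ)
      where
      vanish : ∀ j → horner c (conjugate j) ≈ 0#
      vanish zero    = trans (horner-cong {c = c} (λ _ → refl) (*-identityʳ ω)) e
      vanish (suc j) = begin
        horner c (ω ^ (r ℕ.* r ℕ.^ j))  ≈⟨ horner-cong {c = c} (λ _ → refl)
                                             (trans (^-congʳ ω (ℕₚ.*-comm r (r ℕ.^ j))) (sym (^-* ω (r ℕ.^ j) r))) ⟩
        horner c (conjugate j ^ r)      ≈⟨ horner-^ fixed (conjugate j) ⟨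
        horner c (conjugate j) ^ r      ≈⟨ ^-cong r (vanish j) ⟩
        0# ^ r                          ≈⟨ 0^ 1≤r ⟩
        0#                              ∎

    horner-injective : ∀ {c d : Fin n → Carrier} → (∀ i → Fixed (c i)) → (∀ i → Fixed (d i)) →
                       horner c ω ≈ horner d ω → ∀ i → c i ≈ d i
    horner-injective {c} {d} fc fd e i = x∙y⁻¹≈ε⇒x≈y (c i) (d i)
      (independent (λ i → fixed-minus (fc i) (fd i)) (begin
        h                                    ≈⟨ +-identityʳ h ⟨
        h + 0#                               ≈⟨ +-congˡ (-‿inverseʳ (horner d ω)) ⟨
        h + (horner d ω - horner d ω)        ≈⟨ +-assoc h _ _ ⟨
        h + horner d ω - horner d ω          ≈⟨ +-congʳ (trans (horner-minus c d ω) e) ⟩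
        horner d ω - horner d ω              ≈⟨ -‿inverseʳ _ ⟩
        0#                                   ∎) i)
      where h = horner (λ i → c i - d i) ω

    spanning : (coef : Fin r → Carrier) → Distinct coef → (∀ i → Fixed (coef i)) →
               ∀ z → ∃ λ (d : Fin n → Fin r) → horner (coef ∘ d) ω ≈ z
    spanning coef distinct fixed z =
      let k , e = distinct⇒surjective size≡r^n
                    (λ (k : Fin (r ℕ.^ n)) → horner (coef ∘ finToFun {r} {n} k) ω)
                    (λ k l e → finToFun-injective {r} {n} k l λ i →
                      distinct (finToFun {r} {n} k i) (finToFun {r} {n} l i) (horner-injective (fixed ∘ finToFun {r} {n} k) (fixed ∘ finToFun {r} {n} l) e i)) z
      in finToFun {r} {n} k , e

-- Characteristic p and the Frobenius map.

module Characteristic (F : FiniteField) (p m : ℕ) (pp : Prime p)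
                      (size≡p^m : FiniteField.size F ≡ p ℕ.^ m) where

  open SpanTheory F public
  open SetoidReasoning setoid

  -- (p · 1)^m = p^m · 1 = size · 1 = 0, and a field has no nilpotent elements but 0.
  p·1≈0 : p · 1# ≈ 0#
  p·1≈0 = decidable-stable (_ ≟ _) λ p·1≉0 → ^-≉0 m p·1≉0 (begin
    (p · 1#) ^ m       ≈⟨ ^-· m ⟨
    (p ℕ.^ m) · 1#     ≡⟨ ≡.cong (_· 1#) size≡p^m ⟨
    size · 1#          ≈⟨ size·1≈0 ⟩
    0#                 ∎)
    where
    ^-· : ∀ m → (p ℕ.^ m) · 1# ≈ (p · 1#) ^ m
    ^-· zero    = +-identityʳ 1#
    ^-· (suc m) = trans (×1-homo-* p (p ℕ.^ m)) (*-congˡ (^-· m))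

  multiple·1≈0 : ∀ {n} k → n · 1# ≈ 0# → (k ℕ.* n) · 1# ≈ 0#
  multiple·1≈0 {n} k e = trans (×1-homo-* k n) (trans (*-congˡ e) (zeroʳ _))

  ∣⇒·1≈0 : ∀ {n} → p ∣ n → n · 1# ≈ 0#
  ∣⇒·1≈0 (divides k ≡.refl) = multiple·1≈0 k p·1≈0

  ·1≈0⇒∣ : ∀ {n} → n · 1# ≈ 0# → p ∣ n
  ·1≈0⇒∣ {n} e with p ∣? n
  ... | yes p∣n = p∣n
  ... | no p∤n = ⊥-elim (bezout (coprime-Bézout (prime∤⇒coprime pp p∤n)))
    where
    absurd : ∀ {k l} → k · 1# ≈ 0# → l · 1# ≈ 0# → 1 ℕ.+ k ≡ l → ⊥
    absurd {k} {l} ek el eq = 1≉0 (begin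
      1#              ≈⟨ +-identityʳ 1# ⟨
      1# + 0#         ≈⟨ +-congˡ ek ⟨
      (1 ℕ.+ k) · 1#  ≡⟨ ≡.cong (_· 1#) eq ⟩
      l · 1#          ≈⟨ el ⟩
      0#              ∎)
    bezout : Bézout.Identity 1 n p → ⊥
    bezout (Bézout.+- a b eq) = absurd {b ℕ.* p} {a ℕ.* n} (multiple·1≈0 b p·1≈0) (multiple·1≈0 a e) eq
    bezout (Bézout.-+ a b eq) = absurd {a ℕ.* n} {b ℕ.* p} (multiple·1≈0 a e) (multiple·1≈0 b p·1≈0) eq

  ·≈·1* : ∀ n x → n · x ≈ (n · 1#) * x
  ·≈·1* zero    x = sym (zeroˡ x)
  ·≈·1* (suc n) x = begin
    x + n · x                  ≈⟨ +-cong (sym (*-identityˡ x)) (·≈·1* n x) ⟩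
    1# * x + (n · 1#) * x      ≈⟨ distribʳ x 1# _ ⟨
    (1# + n · 1#) * x          ∎

  frobenius : AdditivePower p
  frobenius x y = go p pp ≡.refl
    where
    open MonoidSum +-commutativeMonoid using (sum; sum-cong-≋; sum-replicate-zero; sum-init-last)
    open Binomial commutativeSemiring using (binomialTerm; theorem)
    -- The exponent is a fresh `q` so that it can be matched as a successor, as the splitting of the
    -- binomial sum requires.
    go : ∀ q → Prime q → q ≡ p → (x + y) ^ q ≈ x ^ q + y ^ q
    go (suc q-1) pq ≡.refl = begin
      (x + y) ^ q                           ≡⟨ ^≡ (x + y) q ⟩
      _                                     ≈⟨ theorem q x y ⟩
      term zero + sum (term ∘ suc)          ≈⟨ +-congˡ (sum-init-last (term ∘ suc)) ⟩
      term zero + (sum (λ (i : Fin q-1) → term (suc (inject₁ i))) + term (fromℕ q))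
        ≈⟨ +-cong first (+-cong (trans (sum-cong-≋ {q-1} middle) (sum-replicate-zero q-1)) last) ⟩
      y ^ q + (0# + x ^ q)                  ≈⟨ +-comm _ _ ⟩
      (0# + x ^ q) + y ^ q                  ≈⟨ +-congʳ (+-identityˡ _) ⟩
      x ^ q + y ^ q                         ∎
      where
      q    = suc q-1
      term = binomialTerm x y q
      first : term zero ≈ y ^ q
      first = begin
        1# * _ + 0#  ≈⟨ +-identityʳ _ ⟩
        1# * _       ≈⟨ *-identityˡ _ ⟩
        _            ≡⟨ ^≡ y q ⟨
        y ^ q        ∎
      last : term (fromℕ q) ≈ x ^ q
      last rewrite Finₚ.toℕ-fromℕ q-1 | nCn≡1 q | ℕₚ.n∸n≡0 q-1 | ^≡ x q-1 = begin
        _ * 1# + 0#  ≈⟨ +-identityʳ _ ⟩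
        _ * 1#       ≈⟨ *-identityʳ _ ⟩
        _            ∎
      middle : ∀ i → term (suc (inject₁ i)) ≈ 0#
      middle i = begin
        (q C k) · z            ≈⟨ ·≈·1* (q C k) z ⟩
        ((q C k) · 1#) * z     ≈⟨ *-congʳ (∣⇒·1≈0 (prime∣binomial pp (s≤s z≤n) k<q)) ⟩
        0# * z                 ≈⟨ zeroˡ z ⟩
        0#                     ∎
        where
        k = suc (toℕ (inject₁ i))
        z = _
        k<q : k ℕ.< q
        k<q = s≤s (≡.subst (ℕ._< q-1) (≡.sym (Finₚ.toℕ-inject₁ i)) (Finₚ.toℕ<n i))

  -- The multiples of 1 form the prime field; with `·1-distinct` they become the coefficients for
  -- spanning `F₁`.
  ·1-fixed : ∀ n → (n · 1#) ^ p ≈ n · 1#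
  ·1-fixed zero    = 0^ (ℕₚ.<⇒≤ (prime⇒>1 pp))
  ·1-fixed (suc n) = trans (frobenius 1# (n · 1#)) (+-cong (1^ p) (·1-fixed n))

  ·1-distinct : Distinct {p} (λ i → toℕ i · 1#)
  ·1-distinct = distinct-from-≤ (_· 1#) injective-≤
    where
    injective-≤ : ∀ k l → k ℕ.≤ l → l ℕ.< p → k · 1# ≈ l · 1# → k ≡ l
    injective-≤ k l k≤l l<p e with ℕₚ.m≤n⇒∃[o]m+o≡n k≤l
    ... | zero  , ≡.refl = ≡.sym (ℕₚ.+-identityʳ k)
    ... | suc o , ≡.refl = ⊥-elim (ℕₚ.<⇒≱ (ℕₚ.≤-<-trans (ℕₚ.m≤n+m (suc o) k) l<p)
      (∣⇒≤ (·1≈0⇒∣ (+-identityʳ-unique (k · 1#) (suc o · 1#)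
        (trans (sym (×-homo-+ 1# k (suc o))) (sym e))))))

-- Polynomials with natural coefficients, evaluated in either field.

-- A polynomial with natural coefficients is represented by the list of the exponents of its monomials.

Poly : Set
Poly = List ℕ

infixl 7 _⊗_
_⊗_ : Poly → Poly → Poly
[]      ⊗ M = []
(l ∷ L) ⊗ M = map (l ℕ.+_) M ++ L ⊗ M

infixr 8 _⊠_
_⊠_ : ℕ → Poly → Poly
zero  ⊠ L = []
suc n ⊠ L = L ++ n ⊠ L

infixr 8 _⊛_
_⊛_ : Poly → ℕ → Poly
L ⊛ zero  = 0 ∷ []
L ⊛ suc n = L ⊗ L ⊛ n

⨂ : ∀ {n} → (Fin n → Poly) → Poly
⨂ {zero}  f = 0 ∷ []
⨂ {suc n} f = f zero ⊗ ⨂ (f ∘ suc)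

-- The coefficients modulo X^N - 1: entry `i` counts the exponents congruent to `i`. The `N` of them
-- match the `N` roots of unity at which a polynomial will be tested.
reduce : ∀ N .{{_ : ℕ.NonZero N}} → Poly → Fin N → ℕ
reduce N []      = λ _ → 0
reduce N (l ∷ L) = updateAt (reduce N L) (l mod N) suc

module Evaluation (F : FiniteField) (p m : ℕ) (pp : Prime p)
                  (size≡p^m : FiniteField.size F ≡ p ℕ.^ m) where

  open Characteristic F p m pp size≡p^m public
  open SetoidReasoning setoid

  eval : Poly → Carrier → Carrier
  eval []      x = 0#
  eval (l ∷ L) x = x ^ l + eval L x

  eval-++ : ∀ L M x → eval (L ++ M) x ≈ eval L x + eval M x
  eval-++ []      M x = sym (+-identityˡ _)
  eval-++ (l ∷ L) M x = trans (+-congˡ (eval-++ L M x)) (sym (+-assoc _ _ _))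

  eval-shift : ∀ l M x → eval (map (l ℕ.+_) M) x ≈ x ^ l * eval M x
  eval-shift l []      x = sym (zeroʳ _)
  eval-shift l (k ∷ M) x = trans (+-cong (^-+ x l k) (eval-shift l M x)) (sym (distribˡ _ _ _))

  eval-⊗ : ∀ L M x → eval (L ⊗ M) x ≈ eval L x * eval M x
  eval-⊗ []      M x = sym (zeroˡ _)
  eval-⊗ (l ∷ L) M x = begin
    eval (map (l ℕ.+_) M ++ L ⊗ M) x              ≈⟨ eval-++ (map (l ℕ.+_) M) (L ⊗ M) x ⟩
    eval (map (l ℕ.+_) M) x + eval (L ⊗ M) x      ≈⟨ +-cong (eval-shift l M x) (eval-⊗ L M x) ⟩
    x ^ l * eval M x + eval L x * eval M x        ≈⟨ distribʳ _ _ _ ⟨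
    (x ^ l + eval L x) * eval M x                 ∎

  eval-⊠ : ∀ n L x → eval (n ⊠ L) x ≈ n · eval L x
  eval-⊠ zero    L x = refl
  eval-⊠ (suc n) L x = trans (eval-++ L (n ⊠ L) x) (+-congˡ (eval-⊠ n L x))

  eval-one : ∀ x → eval (0 ∷ []) x ≈ 1#
  eval-one x = +-identityʳ 1#

  eval-⊛ : ∀ L n x → eval (L ⊛ n) x ≈ eval L x ^ n
  eval-⊛ L zero    x = eval-one x
  eval-⊛ L (suc n) x = trans (eval-⊗ L (L ⊛ n) x) (*-congˡ (eval-⊛ L n x))

  eval-⨂-one : ∀ {n} (f : Fin n → Poly) x → (∀ j → eval (f j) x ≈ 1#) → eval (⨂ f) x ≈ 1#
  eval-⨂-one {zero}  f x _ = eval-one x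
  eval-⨂-one {suc n} f x e = trans (eval-⊗ (f zero) (⨂ (f ∘ suc)) x)
    (trans (*-cong (e zero) (eval-⨂-one (f ∘ suc) x (e ∘ suc))) (*-identityˡ 1#))

  eval-⨂-zero : ∀ {n} (f : Fin n → Poly) x j → eval (f j) x ≈ 0# → eval (⨂ f) x ≈ 0#
  eval-⨂-zero f x zero    e = trans (eval-⊗ (f zero) (⨂ (f ∘ suc)) x) (trans (*-congʳ e) (zeroˡ _))
  eval-⨂-zero f x (suc j) e = trans (eval-⊗ (f zero) (⨂ (f ∘ suc)) x)
    (trans (*-congˡ (eval-⨂-zero (f ∘ suc) x j e)) (zeroʳ _))

  -- p − 1 plays the role of −1.
  +-[p-1]· : ∀ x → x + ℕ.pred p · x ≈ 0#
  +-[p-1]· x = go p p·1≈0 (ℕₚ.<⇒≤ (prime⇒>1 pp))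
    where
    go : ∀ n → n · 1# ≈ 0# → 1 ℕ.≤ n → x + ℕ.pred n · x ≈ 0#
    go (suc n) e _ = trans (·≈·1* (suc n) x) (trans (*-congʳ e) (zeroˡ x))

  infixl 6 _⊖_
  _⊖_ : Poly → Poly → Poly
  L ⊖ M = L ++ ℕ.pred p ⊠ M

  eval-⊖ : ∀ L M x → eval (L ⊖ M) x ≈ eval L x + ℕ.pred p · eval M x
  eval-⊖ L M x = trans (eval-++ L (ℕ.pred p ⊠ M) x) (+-congˡ (eval-⊠ (ℕ.pred p) M x))

  eval-⊖≈0⁺ : ∀ L M {x} → eval L x ≈ eval M x → eval (L ⊖ M) x ≈ 0#
  eval-⊖≈0⁺ L M {x} e = trans (eval-⊖ L M x) (trans (+-congʳ e) (+-[p-1]· _))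

  eval-⊖≈0⁻ : ∀ L M {x} → eval (L ⊖ M) x ≈ 0# → eval L x ≈ eval M x
  eval-⊖≈0⁻ L M {x} e = +-cancelʳ _ _ _
    (trans (sym (eval-⊖ L M x)) (trans e (sym (+-[p-1]· _))))

  eval-reduce : ∀ N .{{_ : ℕ.NonZero N}} L {x} → x ^ N ≈ 1# →
                eval L x ≈ horner (λ i → reduce N L i · 1#) x
  eval-reduce N []      {x} _ = sym (horner-zero {c = λ (_ : Fin N) → 0#} x λ _ → refl)
  eval-reduce N (l ∷ L) {x} e = begin
    x ^ l + eval L x                     ≈⟨ +-cong x^l (eval-reduce N L e) ⟩
    1# * x ^ toℕ (l mod N) + horner c x  ≈⟨ horner-update (l mod N) x
      (reflexive (≡.cong (_· 1#) (updateAt-updates (l mod N) (reduce N L))))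
      (λ i i≢ → reflexive (≡.cong (_· 1#) (updateAt-minimal i (l mod N) (reduce N L) i≢))) ⟨
    horner (λ i → reduce N (l ∷ L) i · 1#) x ∎
    where
    c = λ i → reduce N L i · 1#
    x^l : x ^ l ≈ 1# * x ^ toℕ (l mod N)
    x^l = begin
      x ^ l                                  ≡⟨ ≡.cong (x ^_) (m≡m%n+[m/n]*n l N) ⟩
      x ^ (l % N ℕ.+ l / N ℕ.* N)            ≈⟨ ^-+ x (l % N) (l / N ℕ.* N) ⟩
      x ^ (l % N) * x ^ (l / N ℕ.* N)        ≈⟨ *-congˡ (^≈1-multiple (l / N) e) ⟩
      x ^ (l % N) * 1#                       ≈⟨ *-comm _ _ ⟩
      1# * x ^ (l % N)                       ≡⟨ ≡.cong (λ k → 1# * x ^ k) (Finₚ.toℕ-fromℕ< (m%n<n l N)) ⟨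
      1# * x ^ toℕ (l mod N)                 ∎

-- Embedding the smaller field into the larger one.

record Homomorphism (F₁ F₂ : FiniteField) : Set where
  private
    module A = FiniteField F₁
    module B = FiniteField F₂
  field
    φ      : A.Carrier → B.Carrier
    φ-cong : ∀ {x y} → x A.≈ y → φ x B.≈ φ y
    φ-+    : ∀ x y → φ (x A.+ y) B.≈ φ x B.+ φ y
    φ-*    : ∀ x y → φ (x A.* y) B.≈ φ x B.* φ y
    φ-1    : φ A.1# B.≈ B.1#

module Embedding (F₁ F₂ : FiniteField) (p m₁ m₂ : ℕ) (pp : Prime p)
                 (size₁≡ : FiniteField.size F₁ ≡ p ℕ.^ m₁) (size₂≡ : FiniteField.size F₂ ≡ p ℕ.^ m₂) where

  module A = Evaluation F₁ p m₁ pp size₁≡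
  module B = Evaluation F₂ p m₂ pp size₂≡
  open A using (_⊖_)

  N : ℕ
  N = A.units

  instance
    N≢0 : ℕ.NonZero N
    N≢0 = ℕ.>-nonZero A.1≤units

  -- A polynomial vanishing at all N-th roots of unity of F₂ is a multiple of Xᴺ − 1 modulo p.
  vanishing-transfers : ∀ {g h} → g A.^ N A.≈ A.1# → B.HasOrder h N → ∀ L →
                        (∀ (j : Fin N) → B.eval L (h B.^ toℕ j) B.≈ B.0#) → A.eval L g A.≈ A.0#
  vanishing-transfers {g} {h} g^N o L e = A.trans (A.eval-reduce N L g^N) (A.horner-zero g λ i →
    A.∣⇒·1≈0 {reduce N L i} (B.·1≈0⇒∣ (B.vanishing-coefficients (λ i → reduce N L i B.· B.1#) (λ j → h B.^ toℕ j)
      (B.powers-distinct o)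
      (λ j → B.trans (B.sym (B.eval-reduce N L (root j))) (e j)) i)))
    where
    root : ∀ (j : Fin N) → (h B.^ toℕ j) B.^ N B.≈ B.1#
    root j = B.trans (B.^-swap h (toℕ j) N) (B.trans (B.^-cong (toℕ j) (proj₁ o)) (B.1^ (toℕ j)))

  -- If fⱼ(h^j) ≠ 0 for every j, then ∏ⱼ (1 − fⱼ^(|F₂| − 1)) would be 1 at g and 0 at all h^j.
  common-root : ∀ {g h} → g A.^ N A.≈ A.1# → B.HasOrder h N → (f : Fin N → Poly) →
                (∀ j → A.eval (f j) g A.≈ A.0#) →
                ¬ (∀ j → ¬ (B.eval (f j) (h B.^ toℕ j) B.≈ B.0#))
  common-root {g} {h} g^N o f fg≈0 fh≉0 = A.1≉0 (A.trans (A.sym (A.eval-⨂-one D g D-one))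
    (vanishing-transfers g^N o (⨂ D) λ j → B.eval-⨂-zero D (h B.^ toℕ j) j (D-zero j)))
    where
    D : Fin N → Poly
    D j = (0 ∷ []) ⊖ f j ⊛ B.units
    D-zero : ∀ j → B.eval (D j) (h B.^ toℕ j) B.≈ B.0#
    D-zero j = B.eval-⊖≈0⁺ (0 ∷ []) (f j ⊛ B.units) (B.trans (B.eval-one (h B.^ toℕ j))
      (B.sym (B.trans (B.eval-⊛ (f j) B.units _) (B.fermat (B.eval (f j) (h B.^ toℕ j)) (fh≉0 j)))))
    D-one : ∀ j → A.eval (D j) g A.≈ A.1#
    D-one j = begin
      A.eval (D j) g
        ≈⟨ A.eval-⊖ (0 ∷ []) (f j ⊛ B.units) g ⟩
      A.eval (0 ∷ []) g A.+ ℕ.pred p A.· A.eval (f j ⊛ B.units) g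
        ≈⟨ A.+-cong (A.eval-one g) (A.trans (A.×-congʳ (ℕ.pred p) v≈0) (A.trans (A.·≈·1* (ℕ.pred p) A.0#) (A.zeroʳ _))) ⟩
      A.1# A.+ A.0#
        ≈⟨ A.+-identityʳ _ ⟩
      A.1# ∎
      where
      open SetoidReasoning A.setoid
      v≈0 : A.eval (f j ⊛ B.units) g A.≈ A.0#
      v≈0 = A.trans (A.eval-⊛ (f j) B.units g) (A.trans (A.^-cong B.units (fg≈0 j)) (A.0^ B.1≤units))

  -- Searches the N roots of unity h^j for one at which all relations of `g` vanish; evaluation
  -- there is the homomorphism. If none qualified, a violated relation at each h^j would contradict
  -- `common-root`.
  homomorphism : N ∣ B.units → Homomorphism F₁ F₂
  homomorphism N∣units₂ = build (Finₚ.any? λ (j : Fin N) → All.all? (λ f → B.eval f (h B.^ toℕ j) B.≟ B.0#) relations)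
    where
    g = proj₁ A.generator
    h = proj₁ (B.∃-order N A.1≤units N∣units₂)
    order-h = proj₂ (B.∃-order N A.1≤units N∣units₂)

    -- Zero is the empty sum, a unit the single monomial given by its discrete logarithm.
    log-spec : ∀ x → ∃ λ L → A.eval L g A.≈ x
    log-spec x with x A.≟ A.0#
    ... | yes x≈0 = [] , A.sym x≈0
    ... | no x≉0 =
      let n , e = A.root-of-unity-is-power A.1≤units (proj₂ A.generator) x (A.fermat x x≉0)
      in n ∷ [] , A.trans (A.+-identityʳ _) (A.sym e)

    log : A.Carrier → Poly
    log x = proj₁ (log-spec (A.elt (A.index x)))

    eval-log : ∀ x → A.eval (log x) g A.≈ x
    eval-log x = A.trans (proj₂ (log-spec _)) (A.elt-index x)

    log-cong : ∀ {x y} → x A.≈ y → log x ≡ log y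
    log-cong e = ≡.cong (λ i → proj₁ (log-spec (A.elt i))) (A.index-cong e)

    -- The complete addition and multiplication tables of `F₁`, each entry written as a polynomial
    -- that vanishes at `g`.
    relation+ relation* : Fin (suc N) → Fin (suc N) → Poly
    relation+ i j = (log (A.elt i) ++ log (A.elt j)) ⊖ log (A.elt i A.+ A.elt j)
    relation* i j = (log (A.elt i) ⊗ log (A.elt j)) ⊖ log (A.elt i A.* A.elt j)

    relation1 : Poly
    relation1 = log A.1# ⊖ (0 ∷ [])

    elements : List (Fin (suc N))
    elements = allFin (suc N)

    relations+ relations* relations : List Poly
    relations+ = cartesianProductWith relation+ elements elements
    relations* = cartesianProductWith relation* elements elements
    relations  = relation1 ∷ relations+ ++ relations*

    relations-hold : ∀ {f} → f ∈ relations → A.eval f g A.≈ A.0#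
    relations-hold (here ≡.refl) = A.eval-⊖≈0⁺ (log A.1#) (0 ∷ []) (A.trans (eval-log A.1#) (A.sym (A.eval-one g)))
    relations-hold (there f∈) with ∈-++⁻ relations+ f∈
    ... | inj₁ f∈+ with ∈-cartesianProductWith⁻ relation+ elements elements f∈+
    ...   | i , j , _ , _ , ≡.refl = A.eval-⊖≈0⁺ (log (A.elt i) ++ log (A.elt j)) (log (A.elt i A.+ A.elt j))
      (A.trans (A.eval-++ (log (A.elt i)) _ g) (A.trans (A.+-cong (eval-log _) (eval-log _)) (A.sym (eval-log _))))
    relations-hold (there f∈) | inj₂ f∈* with ∈-cartesianProductWith⁻ relation* elements elements f∈*
    ...   | i , j , _ , _ , ≡.refl = A.eval-⊖≈0⁺ (log (A.elt i) ⊗ log (A.elt j)) (log (A.elt i A.* A.elt j))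
      (A.trans (A.eval-⊗ (log (A.elt i)) _ g) (A.trans (A.*-cong (eval-log _) (eval-log _)) (A.sym (eval-log _))))

    log-elt : ∀ x → log (A.elt (A.index x)) ≡ log x
    log-elt x = log-cong (A.elt-index x)

    build : Dec (∃ λ (j : Fin N) → All (λ f → B.eval f (h B.^ toℕ j) B.≈ B.0#) relations) → Homomorphism F₁ F₂
    build (no ¬h) = ⊥-elim (common-root (proj₁ (proj₂ A.generator)) order-h (proj₁ ∘ violated)
                      (λ j → relations-hold (proj₁ (proj₂ (violated j)))) (λ j → proj₂ (proj₂ (violated j))))
      where
      violated : ∀ j → ∃ λ f → f ∈ relations × ¬ (B.eval f (h B.^ toℕ j) B.≈ B.0#)
      violated j = find (¬All⇒Any¬ (λ f → B.eval f (h B.^ toℕ j) B.≟ B.0#) relations λ all → ¬h (j , all))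
    build (yes (j , hold)) = record
      { φ      = φ
      ; φ-cong = λ e → B.reflexive (≡.cong (λ L → B.eval L y) (log-cong e))
      ; φ-+    = λ x x′ → B.sym (B.trans (B.sym (B.eval-++ (log x) (log x′) y))
                   (B.eval-⊖≈0⁻ (log x ++ log x′) (log (x A.+ x′)) (from-relation+ x x′)))
      ; φ-*    = λ x x′ → B.sym (B.trans (B.sym (B.eval-⊗ (log x) (log x′) y))
                   (B.eval-⊖≈0⁻ (log x ⊗ log x′) (log (x A.* x′)) (from-relation* x x′)))
      ; φ-1    = B.trans (B.eval-⊖≈0⁻ (log A.1#) (0 ∷ []) (All.lookup hold (here ≡.refl))) (B.eval-one y)
      }
      where
      y = h B.^ toℕ j
      φ : A.Carrier → B.Carrier
      φ x = B.eval (log x) y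
      holds : ∀ {f} → f ∈ relations → B.eval f y B.≈ B.0#
      holds = All.lookup hold
      from-relation+ : ∀ x x′ → B.eval ((log x ++ log x′) ⊖ log (x A.+ x′)) y B.≈ B.0#
      from-relation+ x x′ = ≡.subst (λ f → B.eval f y B.≈ B.0#)
        (≡.cong₂ _⊖_ (≡.cong₂ _++_ (log-elt x) (log-elt x′))
                     (log-cong (A.+-cong (A.elt-index x) (A.elt-index x′))))
        (holds (there (∈-++⁺ˡ (∈-cartesianProductWith⁺ relation+ (∈-allFin (A.index x)) (∈-allFin (A.index x′))))))
      from-relation* : ∀ x x′ → B.eval ((log x ⊗ log x′) ⊖ log (x A.* x′)) y B.≈ B.0#
      from-relation* x x′ = ≡.subst (λ f → B.eval f y B.≈ B.0#)
        (≡.cong₂ _⊖_ (≡.cong₂ _⊗_ (log-elt x) (log-elt x′))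
                     (log-cong (A.*-cong (A.elt-index x) (A.elt-index x′))))
        (holds (there (∈-++⁺ʳ relations+ (∈-cartesianProductWith⁺ relation* (∈-allFin (A.index x)) (∈-allFin (A.index x′))))))

-- Least witnesses, finite sums and a divisibility.

least : ∀ {P : ℕ → Set} → Decidable P → ∀ n → P n → ∃ λ m → P m × (∀ k → P k → m ℕ.≤ k)
least {P} P? = <-rec _ step
  where
  step : ∀ n → (∀ {n′} → n′ ℕ.< n → P n′ → ∃ λ m → P m × (∀ k → P k → m ℕ.≤ k)) →
         P n → ∃ λ m → P m × (∀ k → P k → m ℕ.≤ k)
  step n rec Pn with Finₚ.any? (λ (i : Fin n) → P? (toℕ i))
  ... | yes (i , Pi) = rec (Finₚ.toℕ<n i) Pi
  ... | no ¬h = n , Pn , λ k Pk → ℕₚ.≮⇒≥ λ k<n →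
    ¬h (fromℕ< k<n , ≡.subst P (≡.sym (Finₚ.toℕ-fromℕ< k<n)) Pk)

sum : ∀ {n} → (Fin n → ℕ) → ℕ
sum = Vector.foldr ℕ._+_ 0

sum-updateAt-suc : ∀ {n} (f : Fin n → ℕ) i → sum (updateAt f i suc) ≡ suc (sum f)
sum-updateAt-suc f zero    = ≡.refl
sum-updateAt-suc f (suc i) = ≡.trans (≡.cong (f zero ℕ.+_) (sum-updateAt-suc (f ∘ suc) i)) (ℕₚ.+-suc (f zero) _)

sum-zero : ∀ n → sum {n} (λ _ → 0) ≡ 0
sum-zero zero    = ≡.refl
sum-zero (suc n) = sum-zero n

*≤sum : ∀ {n} (f : Fin n → ℕ) {s} → (∀ i → s ℕ.≤ f i) → n ℕ.* s ℕ.≤ sum f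
*≤sum {zero}  f h = z≤n
*≤sum {suc n} f h = ℕₚ.+-mono-≤ (h zero) (*≤sum (f ∘ suc) (h ∘ suc))

-- The cofactor `w` is the geometric sum 1 + q + ... + q^(b-1). The form q^b = 1 + u w keeps
-- truncated subtraction out of the induction.
pred∣pred-^ : ∀ q b → 1 ℕ.≤ q → q ℕ.∸ 1 ∣ q ℕ.^ b ℕ.∸ 1
pred∣pred-^ (suc u) b _ = let w , e = go b in ≡.subst (u ∣_) (≡.cong ℕ.pred (≡.sym e)) (m∣m*n w)
  where
  go : ∀ b → ∃ λ w → suc u ℕ.^ b ≡ suc (u ℕ.* w)
  go zero    = 0 , ≡.cong suc (≡.sym (ℕₚ.*-zeroʳ u))
  go (suc b) = let w , e = go b ; v = suc (u ℕ.* w) in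
    w ℕ.+ v , ≡.trans (≡.cong (suc u ℕ.*_) e) (≡.cong suc (≡.sym (ℕₚ.*-distribˡ-+ u w v)))

-- Signed sums of k-th powers in one field.

module SignedPowerSums (F : FiniteField) (k : ℕ) (1≤k : 1 ℕ.≤ k) where

  open FiniteFieldTheory F
  open RingProperties ring using (-‿distribʳ-*)
  open SetoidReasoning setoid

  Rep : ℕ → Carrier → Set
  Rep s z = Σ (Fin s → Bool) λ ε → Σ (Fin s → Carrier) λ x → signedSum F k s ε x ≈ z

  rep-cong : ∀ {s z w} → z ≈ w → Rep s z → Rep s w
  rep-cong z≈w (ε , x , e) = ε , x , trans e z≈w

  rep-zero : Rep 0 0#
  rep-zero = (λ ()) , (λ ()) , refl

  rep-cons : ∀ {s z} ε x → Rep s z → Rep (suc s) (signed F ε (x ^ k) + z)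
  rep-cons ε x (ε′ , x′ , e) = (ε Vector.∷ ε′) , (x Vector.∷ x′) , +-congˡ e

  signed-cong : ∀ ε {x y} → x ≈ y → signed F ε x ≈ signed F ε y
  signed-cong true  e = e
  signed-cong false e = -‿cong e

  signed-*ʳ : ∀ ε x y → signed F ε (x * y) ≈ x * signed F ε y
  signed-*ʳ true  x y = refl
  signed-*ʳ false x y = -‿distribʳ-* x y

  rep-+ : ∀ {s t z w} → Rep s z → Rep t w → Rep (s ℕ.+ t) (z + w)
  rep-+ {zero}  (ε , x , e) r = rep-cong (trans (sym (+-identityˡ _)) (+-congʳ e)) r
  rep-+ {suc s} (ε , x , e) r = rep-cong (trans (sym (+-assoc _ _ _)) (+-congʳ e))
    (rep-cons (ε zero) (x zero) (rep-+ (ε ∘ suc , x ∘ suc , refl) r))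

  rep-scale : ∀ {s z} v → Rep s z → Rep s (v ^ k * z)
  rep-scale {s} v (ε , x , e) = ε , (λ i → v * x i) , trans (scale s ε x) (*-congˡ e)
    where
    scale : ∀ s ε x → signedSum F k s ε (λ i → v * x i) ≈ v ^ k * signedSum F k s ε x
    scale zero    ε x = sym (zeroʳ _)
    scale (suc s) ε x = trans
      (+-cong (trans (signed-cong (ε zero) (^-distrib-* v (x zero) k)) (signed-*ʳ (ε zero) _ _))
              (scale s (ε ∘ suc) (x ∘ suc)))
      (sym (distribˡ _ _ _))

  rep-pad : ∀ {s t z} → s ℕ.≤ t → Rep s z → Rep t z
  rep-pad {s} {t} {z} s≤t r with ℕₚ.m≤n⇒∃[o]m+o≡n s≤t
  ... | o , ≡.refl = rep-cong (+-identityʳ z) (rep-+ r (zeros o))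
    where
    zeros : ∀ o → Rep o 0#
    zeros zero    = rep-zero
    zeros (suc o) = rep-cong (trans (+-identityʳ _) (0^ 1≤k)) (rep-cons true 0# (zeros o))

  -- Each coefficient costs `s` terms, while multiplication by the k-th power v^k is absorbed into
  -- the bases.
  rep-horner : ∀ {n s} v {c : Fin n → Carrier} → (∀ i → Rep s (c i)) → Rep (n ℕ.* s) (horner c (v ^ k))
  rep-horner {zero}  v r = rep-zero
  rep-horner {suc n} v r = rep-+ (r zero) (rep-scale v (rep-horner v (r ∘ suc)))

  rep-·1 : ∀ n → Rep n (n · 1#)
  rep-·1 zero    = rep-zero
  rep-·1 (suc n) = rep-cong (+-congʳ (1^ k)) (rep-cons true 1# (rep-·1 n))

  -- The sign and the base of the first term range over finite sets; what remains of `z` is decided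
  -- recursively.
  rep? : ∀ s z → Dec (Rep s z)
  rep? zero    z = map′ (λ e → (λ ()) , (λ ()) , e) (λ (_ , _ , e) → e) (0# ≟ z)
  rep? (suc s) z = map′ to from (Finₚ.any? λ i → tail? true i ⊎-dec tail? false i)
    where
    Tail : Bool → Fin (suc units) → Set
    Tail ε i = Rep s (- signed F ε (elt i ^ k) + z)
    tail? : ∀ ε i → Dec (Tail ε i)
    tail? ε i = rep? s (- signed F ε (elt i ^ k) + z)
    cons : ∀ ε i → Tail ε i → Rep (suc s) z
    cons ε i r = rep-cong (begin
      v + (- v + z)   ≈⟨ +-assoc v (- v) z ⟨
      v + - v + z     ≈⟨ +-congʳ (-‿inverseʳ v) ⟩
      0# + z          ≈⟨ +-identityˡ z ⟩
      z               ∎) (rep-cons ε (elt i) r)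
      where v = signed F ε (elt i ^ k)
    to : ∃ (λ i → Tail true i ⊎ Tail false i) → Rep (suc s) z
    to (i , inj₁ r) = cons true i r
    to (i , inj₂ r) = cons false i r
    choose : ∀ ε i → Tail ε i → ∃ (λ i → Tail true i ⊎ Tail false i)
    choose true  i r = i , inj₁ r
    choose false i r = i , inj₂ r
    from : Rep (suc s) z → ∃ (λ i → Tail true i ⊎ Tail false i)
    from (ε , x , e) = choose (ε zero) (index (x zero)) (ε ∘ suc , x ∘ suc , (begin
      S                ≈⟨ +-identityˡ S ⟨
      0# + S           ≈⟨ +-congʳ (-‿inverseˡ w) ⟨
      - w + w + S      ≈⟨ +-assoc (- w) w S ⟩
      - w + (w + S)    ≈⟨ +-cong (-‿cong (signed-cong (ε zero) (^-cong k (elt-index (x zero))))) (sym e) ⟨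
      - signed F (ε zero) (elt (index (x zero)) ^ k) + z ∎))
      where
      S = signedSum F k s (ε ∘ suc) (x ∘ suc)
      w = signed F (ε zero) (x zero ^ k)

  representable? : ∀ s → Dec (Representable F k s)
  representable? s = map′ (λ r z → rep-cong (elt-index z) (r (index z))) (λ r i → r (elt i))
                       (Finₚ.all? λ i → rep? s (elt i))

  ∃-weakWaringNumber : ∀ s → 1 ℕ.≤ s → Representable F k s → ∃ (IsWeakWaringNumber F k)
  ∃-weakWaringNumber s 1≤s r =
    let m , (1≤m , rm) , minimal = least (λ s → (1 ℕ.≤? s) ×-dec representable? s) s (1≤s , r)
    in m , 1≤m , rm , λ t 1≤t rt → minimal t (1≤t , rt)

  -- For s ≥ 2, minimality excludes that every element has s - 1 terms, and a finite search finds an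
  -- exception. For s = 1, minimality over t ≥ 1 says nothing about the empty sum, so 1 is taken as
  -- an element that differs from it.
  ∃-hardest : ∀ {s} → IsWeakWaringNumber F k s → ∃ λ z → ∀ t → Rep t z → s ℕ.≤ t
  ∃-hardest {suc zero}      _ = 1# , λ { zero (_ , _ , e) → ⊥-elim (0≉1 e) ; (suc t) _ → s≤s z≤n }
  ∃-hardest {suc (suc s)} (_ , _ , minimal) =
    let i , ¬r = Finₚ.¬∀⟶∃¬ _ (λ i → Rep (suc s) (elt i)) (λ i → rep? (suc s) (elt i)) λ r →
                   ℕₚ.1+n≰n (minimal (suc s) (s≤s z≤n) λ z → rep-cong (elt-index z) (r (index z)))
    in elt i , λ t rt → ℕₚ.≰⇒> λ t≤ → ¬r (rep-pad t≤ rt)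

-- Properties of field homomorphisms.

module HomomorphismTheory {F₁ F₂ : FiniteField} (hom : Homomorphism F₁ F₂) where

  private
    module A = FiniteFieldTheory F₁
    module B = FiniteFieldTheory F₂
  open Homomorphism hom public

  φ-0 : φ A.0# B.≈ B.0#
  φ-0 = B.x+x≈x⇒x≈0 _ (B.trans (B.sym (φ-+ A.0# A.0#)) (φ-cong (A.+-identityˡ A.0#)))

  φ-neg : ∀ x → φ (A.- x) B.≈ B.- φ x
  φ-neg x = B.+-inverseʳ-unique (φ x) (φ (A.- x))
    (B.trans (B.sym (φ-+ x (A.- x))) (B.trans (φ-cong (A.-‿inverseʳ x)) φ-0))

  φ-signed : ∀ ε x → φ (signed F₁ ε x) B.≈ signed F₂ ε (φ x)
  φ-signed true  x = B.refl
  φ-signed false x = φ-neg x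

  φ-^ : ∀ x n → φ (x A.^ n) B.≈ φ x B.^ n
  φ-^ x zero    = φ-1
  φ-^ x (suc n) = B.trans (φ-* x _) (B.*-congˡ (φ-^ x n))

  φ≈0⇒≈0 : ∀ {x} → φ x B.≈ B.0# → x A.≈ A.0#
  φ≈0⇒≈0 {x} e = decidable-stable (x A.≟ A.0#) λ x≉0 →
    let y , xy≈1 = A.inverse x x≉0
    in B.1≉0 (B.trans (B.sym φ-1) (B.trans (φ-cong (A.sym xy≈1)) (B.trans (φ-* x y)
         (B.trans (B.*-congʳ e) (B.zeroˡ _)))))

  φ-injective : ∀ {x y} → φ x B.≈ φ y → x A.≈ y
  φ-injective {x} {y} e = A.x∙y⁻¹≈ε⇒x≈y x y (φ≈0⇒≈0 (B.trans (φ-+ x (A.- y))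
    (B.trans (B.+-congˡ (φ-neg y)) (B.x≈y⇒x∙y⁻¹≈ε e))))

  φ-order : ∀ {x d} → A.HasOrder x d → B.HasOrder (φ x) d
  φ-order {x} {d} (xd , x∣) = B.trans (B.sym (φ-^ x d)) (B.trans (φ-cong xd) φ-1) ,
    λ n e → x∣ n (φ-injective (B.trans (φ-^ x n) (B.trans e (B.sym φ-1))))

-- Comparison of the two Waring numbers.

module MainArgument
  (p a b c : ℕ) (pp : Prime p) (1≤a : 1 ℕ.≤ a) (1≤b : 1 ℕ.≤ b) (1≤c : 1 ℕ.≤ c)
  (c-minimal : ∀ t → 1 ℕ.≤ t → t ℕ.< a → ¬ (c ∣ p ℕ.^ t ℕ.∸ 1))
  (bc-minimal : ∀ t → 1 ℕ.≤ t → t ℕ.< a ℕ.* b → ¬ (b ℕ.* c ∣ p ℕ.^ t ℕ.∸ 1))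
  (k₁ k₂ : ℕ) (k₁c≡ : k₁ ℕ.* c ≡ p ℕ.^ a ℕ.∸ 1) (k₂bc≡ : k₂ ℕ.* (b ℕ.* c) ≡ p ℕ.^ (a ℕ.* b) ℕ.∸ 1)
  (F₁ F₂ : FiniteField)
  (size₁≡ : FiniteField.size F₁ ≡ p ℕ.^ a) (size₂≡ : FiniteField.size F₂ ≡ p ℕ.^ (a ℕ.* b)) where

  open Embedding F₁ F₂ p a (a ℕ.* b) pp size₁≡ size₂≡

  q : ℕ
  q = p ℕ.^ a

  1≤p : 1 ℕ.≤ p
  1≤p = ℕₚ.<⇒≤ (prime⇒>1 pp)

  1≤q : 1 ℕ.≤ q
  1≤q = ℕₚ.m^n>0 p {{prime⇒nonZero pp}} a

  k₁c≡units : k₁ ℕ.* c ≡ A.units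
  k₁c≡units = ≡.trans k₁c≡ (≡.cong ℕ.pred (≡.sym size₁≡))

  k₂bc≡units : k₂ ℕ.* (b ℕ.* c) ≡ B.units
  k₂bc≡units = ≡.trans k₂bc≡ (≡.cong ℕ.pred (≡.sym size₂≡))

  1≤k₁ : 1 ℕ.≤ k₁
  1≤k₁ = ℕₚ.n≢0⇒n>0 λ k≡0 → ℕₚ.<⇒≢ A.1≤units (≡.trans (≡.cong (ℕ._* c) (≡.sym k≡0)) k₁c≡units)

  1≤k₂ : 1 ℕ.≤ k₂
  1≤k₂ = ℕₚ.n≢0⇒n>0 λ k≡0 → ℕₚ.<⇒≢ B.1≤units (≡.trans (≡.cong (ℕ._* (b ℕ.* c)) (≡.sym k≡0)) k₂bc≡units)

  1≤bc : 1 ℕ.≤ b ℕ.* c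
  1≤bc = ℕₚ.*-mono-≤ 1≤b 1≤c

  module S₁ = SignedPowerSums F₁ k₁ 1≤k₁
  module S₂ = SignedPowerSums F₂ k₂ 1≤k₂

  -- `ζ` and `ω` are explicit powers of generators, so they have the shape v^k at which `rep-horner`
  -- evaluates.
  g₁ ζ : A.Carrier
  g₁ = proj₁ A.generator
  ζ  = g₁ A.^ k₁

  g₂ ω : B.Carrier
  g₂ = proj₁ B.generator
  ω  = g₂ B.^ k₂

  ζ-order : A.HasOrder ζ c
  ζ-order = A.order-^ k₁ c 1≤k₁ (≡.subst (A.HasOrder g₁) (≡.sym k₁c≡units) (proj₂ A.generator))

  ω-order : B.HasOrder ω (b ℕ.* c)
  ω-order = B.order-^ k₂ (b ℕ.* c) 1≤k₂ (≡.subst (B.HasOrder g₂) (≡.sym k₂bc≡units) (proj₂ B.generator))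

  ζ-moved : ∀ t → 1 ℕ.≤ t → t ℕ.< a → ¬ (ζ A.^ (p ℕ.^ t) A.≈ ζ)
  ζ-moved t 1≤t t<a e = c-minimal t 1≤t t<a (A.order∣pred 1≤c ζ-order (ℕₚ.m^n>0 p {{prime⇒nonZero pp}} t) e)

  -- q^t = p^(a t) with a t < a b, a range in which bc does not divide p^(a t) - 1.
  ω-moved : ∀ t → 1 ℕ.≤ t → t ℕ.< b → ¬ (ω B.^ (q ℕ.^ t) B.≈ ω)
  ω-moved t 1≤t t<b e = bc-minimal (a ℕ.* t) (ℕₚ.*-mono-≤ 1≤a 1≤t)
    (ℕₚ.*-monoʳ-< a {{ℕ.>-nonZero 1≤a}} t<b)
    (≡.subst (λ n → b ℕ.* c ∣ n ℕ.∸ 1) (ℕₚ.^-*-assoc p a t)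
      (B.order∣pred 1≤bc ω-order (ℕₚ.m^n>0 q {{ℕ.>-nonZero 1≤q}} t) e))

  module Span₁ = A.Span p a 1≤p A.frobenius size₁≡ ζ ζ-moved
  module Span₂ = B.Span q b 1≤q (B.additive-^ B.frobenius a)
                   (≡.trans size₂≡ (≡.sym (ℕₚ.^-*-assoc p a b))) ω ω-moved

  -- Each of the `a` coordinates over the prime field is n · 1 with n < p, that is n copies of 1^k₁
  -- padded to p terms. The value a p is only a crude start for the search for the least number.
  representable₁ : Representable F₁ k₁ (a ℕ.* p)
  representable₁ z =
    let d , e = Span₁.spanning (λ i → toℕ i A.· A.1#) A.·1-distinct (A.·1-fixed ∘ toℕ) z
    in S₁.rep-cong e (S₁.rep-horner g₁ λ i → S₁.rep-pad (ℕₚ.<⇒≤ (Finₚ.toℕ<n (d i))) (S₁.rep-·1 (toℕ (d i))))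

  units₁∣units₂ : A.units ∣ B.units
  units₁∣units₂ = ≡.subst₂ _∣_ (≡.cong ℕ.pred (≡.sym size₁≡))
    (≡.trans (≡.cong ℕ.pred (ℕₚ.^-*-assoc p a b)) (≡.cong ℕ.pred (≡.sym size₂≡))) (pred∣pred-^ q b 1≤q)

  -- Unfolding the search behind the embedding would make conversion checking intractable.
  abstract
    embedding : Homomorphism F₁ F₂
    embedding = homomorphism units₁∣units₂

  open HomomorphismTheory embedding

  φ-fixed : ∀ x → Span₂.Fixed (φ x)
  φ-fixed x = B.trans (B.sym (φ-^ x q)) (φ-cong (A.trans (A.^-congʳ x (≡.sym size₁≡)) (A.^size x)))

  -- The image of `φ` supplies q distinct fixed elements, so the coefficients of the span can be
  -- taken in `F₁` itself.
  coordinates : ∀ z → ∃ λ (y : Fin b → A.Carrier) → B.horner (φ ∘ y) ω B.≈ z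
  coordinates z =
    let d , e = Span₂.spanning (λ i → φ (A.enum (cast q≡size i)))
                  (λ i j e → Finₚ.toℕ-injective (≡.trans (≡.sym (Finₚ.toℕ-cast q≡size i))
                    (≡.trans (≡.cong toℕ (A.enum-inj _ _ (φ-injective e))) (Finₚ.toℕ-cast q≡size j))))
                  (λ i → φ-fixed _) z
    in (λ i → A.enum (cast q≡size (d i))) , e
    where
    q≡size : q ≡ A.size
    q≡size = ≡.sym size₁≡

  -- For x ≠ 0 the image of x^k₁ is a c-th root of unity, hence a bc-th root of unity, hence a k₂-th
  -- power.
  φ-power : ∀ x → ∃ λ y → y B.^ k₂ B.≈ φ (x A.^ k₁)
  φ-power x with x A.≟ A.0#
  ... | yes x≈0 = B.0# , B.trans (B.0^ 1≤k₂) (B.sym (B.trans (φ-cong (A.trans (A.^-cong k₁ x≈0) (A.0^ 1≤k₁))) φ-0))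
  ... | no x≉0 = B.root-of-unity⇒power {k₂} {b ℕ.* c} k₂bc≡units (B.^≈1-multiple b
    (B.trans (B.sym (φ-^ (x A.^ k₁) c)) (B.trans (φ-cong (A.power⇒root-of-unity {k₁} {c} k₁c≡units x≉0)) φ-1)))

  φ-rep : ∀ {s z} → S₁.Rep s z → S₂.Rep s (φ z)
  φ-rep {zero}  (ε , x , e) = S₂.rep-cong (B.trans (B.sym φ-0) (φ-cong e)) S₂.rep-zero
  φ-rep {suc s} (ε , x , e) =
    let y , ey = φ-power (x zero)
    in S₂.rep-cong
         (B.trans (B.+-congʳ (B.trans (S₂.signed-cong (ε zero) ey) (B.sym (φ-signed (ε zero) _))))
                  (B.trans (B.sym (φ-+ _ _)) (φ-cong e)))
         (S₂.rep-cons (ε zero) y (φ-rep (ε ∘ suc , x ∘ suc , A.refl)))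

  representable₂ : ∀ {s} → Representable F₁ k₁ s → Representable F₂ k₂ (b ℕ.* s)
  representable₂ r z =
    let y , e = coordinates z
    in S₂.rep-cong e (S₂.rep-horner g₂ λ i → φ-rep (r (y i)))

  -- The bc-th roots of unity are the ω^i φ(v) with i < b and v a c-th root of unity.
  power-split : ∀ x → ∃₂ λ (i : Fin b) v → x B.^ k₂ B.≈ φ (v A.^ k₁) B.* ω B.^ toℕ i
  power-split x with x B.≟ B.0#
  ... | yes x≈0 = fromℕ< 1≤b , A.0# ,
    B.trans (B.trans (B.^-cong k₂ x≈0) (B.0^ 1≤k₂)) (B.sym (B.trans
      (B.*-congʳ (B.trans (φ-cong (A.0^ 1≤k₁)) φ-0)) (B.zeroˡ _)))
  ... | no x≉0 = n mod b , g₁ A.^ m , (begin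
      x B.^ k₂                                   ≈⟨ x^k₂ ⟩
      ω B.^ n                                    ≡⟨ ≡.cong (ω B.^_) (m≡m%n+[m/n]*n n b) ⟩
      ω B.^ (n % b ℕ.+ n / b ℕ.* b)              ≈⟨ B.^-+ ω (n % b) (n / b ℕ.* b) ⟩
      ω B.^ (n % b) B.* ω B.^ (n / b ℕ.* b)      ≈⟨ B.*-comm _ _ ⟩
      ω B.^ (n / b ℕ.* b) B.* ω B.^ (n % b)      ≈⟨ B.*-cong u-power (B.^-congʳ ω (≡.sym (Finₚ.toℕ-fromℕ< (m%n<n n b)))) ⟩
      φ ((g₁ A.^ m) A.^ k₁) B.* ω B.^ toℕ (n mod b) ∎)
    where
    open SetoidReasoning B.setoid
    instance
      b≢0 : ℕ.NonZero b
      b≢0 = ℕ.>-nonZero 1≤b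
    log-x = B.root-of-unity-is-power 1≤bc ω-order (x B.^ k₂) (B.power⇒root-of-unity {k₂} {b ℕ.* c} k₂bc≡units x≉0)
    n = proj₁ log-x
    x^k₂ = proj₂ log-x
    u : B.Carrier
    u = ω B.^ (n / b ℕ.* b)
    u^c : u B.^ c B.≈ B.1#
    u^c = B.trans (B.^-* ω (n / b ℕ.* b) c) (B.trans (B.^-congʳ ω (ℕₚ.*-assoc (n / b) b c))
            (B.^≈1-multiple (n / b) (proj₁ ω-order)))
    -- `φ ζ` still has order c in `F₂`, so its powers exhaust the c-th roots of unity there, among
    -- them `u`.
    log-u = B.root-of-unity-is-power 1≤c (φ-order ζ-order) u u^c
    m = proj₁ log-u
    u-power : u B.≈ φ ((g₁ A.^ m) A.^ k₁)
    u-power = B.trans (proj₂ log-u) (B.trans (B.sym (φ-^ ζ m)) (φ-cong (A.^-swap g₁ k₁ m)))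

  -- By `power-split` each term ±x^k₂ lies on one line ω^i. It becomes one signed k₁-th power in
  -- coordinate i and raises only the count `n i`, so the counts add up to t.
  decompose : ∀ t {z} → S₂.Rep t z → ∃₂ λ (y : Fin b → A.Carrier) (n : Fin b → ℕ) →
              sum n ≡ t × (∀ i → S₁.Rep (n i) (y i)) × B.horner (φ ∘ y) ω B.≈ z
  decompose zero    (ε , x , e) = (λ _ → A.0#) , (λ _ → 0) , sum-zero b , (λ _ → S₁.rep-zero) ,
    B.trans (B.horner-zero {c = λ (_ : Fin b) → φ A.0#} ω λ _ → φ-0) e
  decompose (suc t) {z} (ε , x , e) with decompose t (ε ∘ suc , x ∘ suc , B.refl) | power-split (x zero)
  ... | y , n , sum-n , rep , ey | i , v , ev =
    y′ , n′ , ≡.trans (sum-updateAt-suc n i) (≡.cong suc sum-n) , rep′ , (begin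
      B.horner (φ ∘ y′) ω
        ≈⟨ B.horner-update i ω
             (B.trans (B.reflexive (≡.cong φ (updateAt-updates i y))) (φ-+ w (y i)))
             (λ j j≢i → B.reflexive (≡.cong φ (updateAt-minimal j i y j≢i))) ⟩
      φ w B.* ω B.^ toℕ i B.+ B.horner (φ ∘ y) ω
        ≈⟨ B.+-cong head ey ⟩
      signed F₂ (ε zero) (x zero B.^ k₂) B.+ signedSum F₂ k₂ t (ε ∘ suc) (x ∘ suc)
        ≈⟨ e ⟩
      z ∎)
    where
    open SetoidReasoning B.setoid
    w : A.Carrier
    w = signed F₁ (ε zero) (v A.^ k₁)
    y′ : Fin b → A.Carrier
    y′ = updateAt y i (w A.+_)
    n′ : Fin b → ℕ
    n′ = updateAt n i suc
    rep′ : ∀ j → S₁.Rep (n′ j) (y′ j)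
    rep′ j with j Finₚ.≟ i
    ... | yes ≡.refl = ≡.subst₂ S₁.Rep (≡.sym (updateAt-updates i n)) (≡.sym (updateAt-updates i y))
                         (S₁.rep-cons (ε zero) v (rep i))
    ... | no j≢i = ≡.subst₂ S₁.Rep (≡.sym (updateAt-minimal j i n j≢i)) (≡.sym (updateAt-minimal j i y j≢i)) (rep j)
    head : φ w B.* ω B.^ toℕ i B.≈ signed F₂ (ε zero) (x zero B.^ k₂)
    head = begin
      φ w B.* ω B.^ toℕ i                                    ≈⟨ B.*-comm _ _ ⟩
      ω B.^ toℕ i B.* φ w                                    ≈⟨ B.*-congˡ (φ-signed (ε zero) _) ⟩
      ω B.^ toℕ i B.* signed F₂ (ε zero) (φ (v A.^ k₁))      ≈⟨ S₂.signed-*ʳ (ε zero) _ _ ⟨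
      signed F₂ (ε zero) (ω B.^ toℕ i B.* φ (v A.^ k₁))      ≈⟨ S₂.signed-cong (ε zero) (B.trans (B.*-comm _ _) (B.sym ev)) ⟩
      signed F₂ (ε zero) (x zero B.^ k₂)                     ∎

  lower-bound : ∀ {s} → IsWeakWaringNumber F₁ k₁ s → ∀ t → Representable F₂ k₂ t → b ℕ.* s ℕ.≤ t
  lower-bound {s} ws t r =
    let z , hard                   = S₁.∃-hardest ws
        y , n , sum-n , rep , e    = decompose t (r (B.horner (λ (_ : Fin b) → φ z) ω))
        -- Both coordinate vectors consist of fixed elements and have the same value at ω, so
        -- uniqueness makes every `y i` equal to the hardest `z`.
        y≈z                        = λ i → φ-injective (Span₂.horner-injective (φ-fixed ∘ y) (λ _ → φ-fixed z) e i)
    in ≡.subst (b ℕ.* s ℕ.≤_) sum-n (*≤sum n λ i → hard (n i) (S₁.rep-cong (y≈z i) (rep i)))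

  conclusion : Σ ℕ λ s → IsWeakWaringNumber F₁ k₁ s × IsWeakWaringNumber F₂ k₂ (b ℕ.* s)
  conclusion =
    let s , ws@(1≤s , r , _) = S₁.∃-weakWaringNumber (a ℕ.* p) (ℕₚ.*-mono-≤ 1≤a 1≤p) representable₁
    in s , ws , ℕₚ.*-mono-≤ 1≤b 1≤s , representable₂ r , λ t _ rt → lower-bound ws t rt

open import Data.Nat using (_*_; _∸_; _^_; _≤_)

theorem8p9 : (p a b c : ℕ) → Prime p → 1 ≤ a → 1 ≤ b → 1 ≤ c →
    PrimitiveDivisor c p a → PrimitiveDivisor (b * c) p (a * b) →
    (k₁ k₂ : ℕ) → k₁ * c ≡ p ^ a ∸ 1 → k₂ * (b * c) ≡ p ^ (a * b) ∸ 1 →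
    (F₁ F₂ : FiniteField) → FiniteField.size F₁ ≡ p ^ a → FiniteField.size F₂ ≡ p ^ (a * b) →
    Σ ℕ λ s → IsWeakWaringNumber F₁ k₁ s × IsWeakWaringNumber F₂ k₂ (b * s)
theorem8p9 p a b c pp 1≤a 1≤b 1≤c (_ , c-minimal) (_ , bc-minimal) k₁ k₂ k₁c≡ k₂bc≡ F₁ F₂ size₁≡ size₂≡ =
  MainArgument.conclusion p a b c pp 1≤a 1≤b 1≤c c-minimal bc-minimal k₁ k₂ k₁c≡ k₂bc≡ F₁ F₂ size₁≡ size₂≡
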